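{- Let $B_{80,4}$ be the binary code of length $80$ with generator matrix $$\left(\begin{array}{c|cccc} & 0 & 1 & \cdots & 1\\ & 1 & & & \\ I_{40} & \vdots & & R & \\ & 1 & & & \end{array}\right),$$ where $I_{40}$ is the identity matrix of order $40$ and $R$ is the $39\times 39$ circulant matrix with first row $$(111100000100101111101011101001101100011).$$ Let $x_{80}\in\mathbb{F}_2^{80}$ be the vector with support $$\{ 2, 5, 8, 11, 14, 17, 20, 23, 26, 29, 32, 35, 38\}.$$ Then the code $C_{82}=B_{80,4}(x_{80})$ is a singly even self-dual $[82,41,14]$ code with minimal shadow.
   Context: All codes are binary: a code of length $n$ is a subspace of $\mathbb{F}_2^n$, and $[n,k,d]$ denotes length $n$, dimension $k$, minimum weight $d$. Coordinates are numbered $1,\dots,n$. A code $C$ is self-dual if $C=C^\perp$ with respect to the standard inner product. A self-dual code is doubly even if all codeword weights are $\equiv 0 \pmod 4$, and singly even if it contains a codeword of weight $\equiv 2 \pmod 4$. A circulant matrix is one in which each row is the cyclic shift of the previous row by one position to the right. The code $B_{80,4}$ is a known extremal doubly even self-dual $[80,40,16]$ code. Construction of $C(x)$: let $C$ be a doubly even self-dual code of length $8t$ and $x\in\mathbb{F}_2^{8t}$ a vector of odd weight. Let $C^0$ be the subcode of $C$ consisting of all codewords orthogonal to $x$. There are cosets $C^1,C^2,C^3$ of $C^0$ such that $(C^0)^\perp = C^0\cup C^1\cup C^2\cup C^3$, where $C=C^0\cup C^2$ and $x+C=C^1\cup C^3$. Then $$C(x)= (0,0,C^0) \cup (1,1,C^2)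 \cup (1,0,C^1) \cup (0,1,C^3)\subseteq\mathbb{F}_2^{8t+2},$$ where $(a,b,C^i)=\{(a,b,c)\mid c\in C^i\}$. (Interchanging the names $C^1$ and $C^3$ only interchanges the first two coordinates of $C(x)$.) For a singly even self-dual code $D$, let $D_0$ be the subcode of codewords of weight $\equiv 0\pmod 4$; the shadow of $D$ is $D_0^\perp\setminus D$. A singly even self-dual code of length $n$ is said to have minimal shadow if the minimum weight of its shadow is $4,1,2,3$ when $n\equiv 0,2,4,6 \pmod 8$, respectively (so for length $82$ the shadow has minimum weight $1$). -}

module Defs where

open import Data.Bool.Base using (Bool; true; false; _∧_; _xor_)
open import Data.Fin.Base using (toℕ)
open import Data.Fin.Subset using (∣_∣)
open import Data.List.Base using (List; []; _∷_)
open import Data.Nat.Base using (ℕ; suc; _+_; _≤_; _%_)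
open import Data.Nat.Divisibility using (_∣_)
open import Data.Nat.Properties using (_≟_)
open import Data.Product.Base using (Σ-syntax; ∃-syntax; _×_)
open import Data.Sum.Base using (_⊎_)
open import Data.Vec.Base using (Vec; []; _∷_; _++_; foldr′; init; iterate; last; map; replicate; tabulate; zipWith)
open import Level using (0ℓ)
open import Relation.Binary.PropositionalEquality using (_≡_; _≢_)
open import Relation.Nullary.Decidable using (does)
open import Relation.Unary using (Pred; _∈_; _∪_; _∩_; _∖_; _≐_)

import Data.List.Membership.DecPropositional as DecMembership

------------------------------------------------------------------------
-- Binary words

-- The field with two elements is Bool with _xor_ as addition and _∧_ as
-- multiplication (Data.Bool.Properties.xor-∧-commutativeRing).

F₂ : Set
F₂ = Bool

pattern 0₂ = false
pattern 1₂ = true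

Word : ℕ → Set
Word n = Vec F₂ n

private
  variable
    n k : ℕ

𝟎 : Word n
𝟎 = replicate _ 0₂

infix 4 _IsCosetOf_
infixl 6 _⊕_
infixl 7 _•_ _·_

_⊕_ : Word n → Word n → Word n
_⊕_ = zipWith _xor_

_•_ : F₂ → Word n → Word n
a • v = map (a ∧_) v

_·_ : Word n → Word n → F₂
u · v = foldr′ _xor_ 0₂ (zipWith _∧_ u v)

weight : Word n → ℕ
weight = ∣_∣

------------------------------------------------------------------------
-- Linear algebra over F₂

linearCombination : Word k → Vec (Word n) k → Word n
linearCombination []       []       = 𝟎
linearCombination (a ∷ as) (v ∷ vs) = a • v ⊕ linearCombination as vs

span : Vec (Word n) k → Pred (Word n) 0ℓ
span vs v = ∃[ as ] linearCombination as vs ≡ v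

LinearlyIndependent : Vec (Word n) k → Set
LinearlyIndependent vs = ∀ as → linearCombination as vs ≡ 𝟎 → as ≡ 𝟎

-- Closure under scalar multiplication is automatic over F₂.

record IsSubspace (C : Pred (Word n) 0ℓ) : Set where
  field
    𝟎-closed : 𝟎 ∈ C
    ⊕-closed : ∀ {u v} → u ∈ C → v ∈ C → u ⊕ v ∈ C

HasDimension : Pred (Word n) 0ℓ → ℕ → Set
HasDimension {n} C k = Σ[ vs ∈ Vec (Word n) k ] LinearlyIndependent vs × span vs ≐ C

translate : Word n → Pred (Word n) 0ℓ → Pred (Word n) 0ℓ
translate u S v = ∃[ s ] s ∈ S × v ≡ u ⊕ s

_IsCosetOf_ : Pred (Word n) 0ℓ → Pred (Word n) 0ℓ → Set
S IsCosetOf C = ∃[ u ] S ≐ translate u C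

------------------------------------------------------------------------
-- Codes

dual : Pred (Word n) 0ℓ → Pred (Word n) 0ℓ
dual C v = ∀ {c} → c ∈ C → v · c ≡ 0₂

LeastWeight : Pred (Word n) 0ℓ → ℕ → Set
LeastWeight S d = (∃[ v ] v ∈ S × weight v ≡ d) × (∀ {v} → v ∈ S → d ≤ weight v)

MinimumWeight : Pred (Word n) 0ℓ → ℕ → Set
MinimumWeight C = LeastWeight (C ∩ (_≢ 𝟎))

record Is[_,_,_]Code (n k d : ℕ) (C : Pred (Word n) 0ℓ) : Set where
  field
    isSubspace    : IsSubspace C
    dimension     : HasDimension C k
    minimumWeight : MinimumWeight C d

SelfDual : Pred (Word n) 0ℓ → Set
SelfDual C = C ≐ dual C

record DoublyEvenSelfDual (C : Pred (Word n) 0ℓ) : Set where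
  field
    selfDual   : SelfDual C
    doublyEven : ∀ {c} → c ∈ C → weight c % 4 ≡ 0

record SinglyEvenSelfDual (C : Pred (Word n) 0ℓ) : Set where
  field
    selfDual   : SelfDual C
    singlyEven : ∃[ c ] c ∈ C × weight c % 4 ≡ 2

shadow : Pred (Word n) 0ℓ → Pred (Word n) 0ℓ
shadow D = dual D₀ ∖ D
  where
  D₀ = D ∩ λ v → weight v % 4 ≡ 0

HasMinimalShadow : Pred (Word n) 0ℓ → Set
HasMinimalShadow {n} D =
    (n % 8 ≡ 0 × LeastWeight (shadow D) 4)
  ⊎ (n % 8 ≡ 2 × LeastWeight (shadow D) 1)
  ⊎ (n % 8 ≡ 4 × LeastWeight (shadow D) 2)
  ⊎ (n % 8 ≡ 6 × LeastWeight (shadow D) 3)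

------------------------------------------------------------------------
-- The code C(x)

orthogonalSubcode : Pred (Word n) 0ℓ → Word n → Pred (Word n) 0ℓ
orthogonalSubcode C x = C ∩ λ c → c · x ≡ 0₂

prepend : F₂ → F₂ → Pred (Word n) 0ℓ → Pred (Word (2 + n)) 0ℓ
prepend a b S v = ∃[ c ] c ∈ S × v ≡ a ∷ b ∷ c

-- All that is needed to form C(x). The conditions leave one choice, which
-- of the two cosets making up x + C is called C¹, so C(x) depends on the
-- element of this record, up to interchanging the first two coordinates.

record Extension (C : Pred (Word n) 0ℓ) (x : Word n) : Set₁ where
  field
    8∣n                : 8 ∣ n
    doublyEvenSelfDual : DoublyEvenSelfDual C
    oddWeight          : weight x % 2 ≡ 1

  C⁰ : Pred (Word n) 0ℓ
  C⁰ = orthogonalSubcode C x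

  field
    C¹ C² C³  : Pred (Word n) 0ℓ
    C¹-coset  : C¹ IsCosetOf C⁰
    C²-coset  : C² IsCosetOf C⁰
    C³-coset  : C³ IsCosetOf C⁰
    dual-C⁰   : dual C⁰ ≐ C⁰ ∪ C¹ ∪ C² ∪ C³
    C-union   : C ≐ C⁰ ∪ C²
    x+C-union : translate x C ≐ C¹ ∪ C³

  code : Pred (Word (2 + n)) 0ℓ
  code = prepend 0₂ 0₂ C⁰ ∪ prepend 1₂ 1₂ C² ∪ prepend 1₂ 0₂ C¹ ∪ prepend 0₂ 1₂ C³

------------------------------------------------------------------------
-- The code B₈₀,₄ and the vector x₈₀

identityMatrix : ∀ n → Vec (Word n) n
identityMatrix n = tabulate λ i → tabulate λ j → does (toℕ i ≟ toℕ j)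

shiftRight : Word n → Word n
shiftRight {0}     v = v
shiftRight {suc _} v = last v ∷ init v

circulant : Word n → Vec (Word n) n
circulant {n} r = iterate shiftRight r n

R-firstRow : Word 39
R-firstRow =
  1₂ ∷ 1₂ ∷ 1₂ ∷ 1₂ ∷ 0₂ ∷ 0₂ ∷ 0₂ ∷ 0₂ ∷ 0₂ ∷ 1₂ ∷
  0₂ ∷ 0₂ ∷ 1₂ ∷ 0₂ ∷ 1₂ ∷ 1₂ ∷ 1₂ ∷ 1₂ ∷ 1₂ ∷ 0₂ ∷
  1₂ ∷ 0₂ ∷ 1₂ ∷ 1₂ ∷ 1₂ ∷ 0₂ ∷ 1₂ ∷ 0₂ ∷ 0₂ ∷ 1₂ ∷
  1₂ ∷ 0₂ ∷ 1₂ ∷ 1₂ ∷ 0₂ ∷ 0₂ ∷ 0₂ ∷ 1₂ ∷ 1₂ ∷ []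

R : Vec (Word 39) 39
R = circulant R-firstRow

borderedR : Vec (Word 40) 40
borderedR = (0₂ ∷ replicate 39 1₂) ∷ map (1₂ ∷_) R

generatorMatrix : Vec (Word 80) 40
generatorMatrix = zipWith _++_ (identityMatrix 40) borderedR

B₈₀,₄ : Pred (Word 80) 0ℓ
B₈₀,₄ = span generatorMatrix

-- Supports list coordinates numbered from 1.

withSupport : List ℕ → Word n
withSupport ps = tabulate λ i → does (suc (toℕ i) ∈? ps)
  where open DecMembership _≟_ using (_∈?_)

x₈₀ : Word 80
x₈₀ = withSupport (2 ∷ 5 ∷ 8 ∷ 11 ∷ 14 ∷ 17 ∷ 20 ∷ 23 ∷ 26 ∷ 29 ∷ 32 ∷ 35 ∷ 38 ∷ [])

{-# OPTIONS --safe #-}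

-- Write B = { u ++ uM } with M the bordered circulant. Since M Mᵗ = I, the
-- code B is self-dual, and a codeword is determined by either half: its left
-- half is its right half times Mᵗ. Up to the order of the first two
-- coordinates, C(x) consists of the sums ε(1,0,x) + (c·x, c·x, c) with c ∈ B,
-- and self-duality, dimension and shadow are read off this form. Words of
-- C(x) have even weight, so the minimum weight is 14 as soon as nonzero words
-- of B have weight at least 13 and words of x + B weight at least 12. A word
-- of B of weight at most 12 has weight at most 6 on the left or at most 5 on
-- the right, and a word of x + B of weight at most 11 has weight at most 5 on
-- one side; all such halves are enumerated by evaluation. For B the cyclic
-- automorphism of order 39 lets one coordinate of the half be fixed.

module Submission where

open import Algebra.Bundles using (CommutativeMonoid; CommutativeRing; CommutativeSemigroup)
open import Data.Bool.Base using (Bool; true; false; not; _∧_; _xor_)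
open import Data.Bool.Properties using (∧-comm; ∧-conicalʳ; ∧-conicalˡ; ∧-distribʳ-xor; ∧-idem; ∧-identityʳ; ∧-zeroʳ; not-injective; not-¬; ¬-not; xor-assoc; xor-comm; xor-identityʳ; xor-identityˡ; xor-inverseʳ; xor-inverseˡ; xor-same; xor-∧-commutativeRing) renaming (_≟_ to _≟₂_)
open import Data.Fin.Base using (Fin; toℕ)
open import Data.List.Base as List using (List; []; _∷_)
open import Data.List.Properties as List using (∷-injectiveʳ; ∷-injectiveˡ; ++-assoc)
open import Data.Nat.Base
open import Data.Nat.Divisibility
open import Data.Nat.Properties using (+-cancelˡ-≤; +-comm; +-monoˡ-≤; +-suc; m≤n+m; n≢0⇒n>0; n≤0⇒n≡0; ≤-pred; ≤-refl; ≤-reflexive; ≤-trans; ≤∧≢⇒<; ≰⇒>; <⇒≱; _≟_; _≤?_)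
open import Data.Nat.Tactic.RingSolver using (solve-∀)
open import Data.Product.Base using (∃-syntax; _×_; _,_; proj₁; proj₂)
open import Data.Sum.Base using (_⊎_; inj₁; inj₂)
open import Data.Vec.Base using (Vec; []; _∷_; _++_; _∷ʳ_; drop; foldr′; map; splitAt; tabulate; tail; take; toList; zipWith)
open import Data.Vec.Properties using (++-injectiveˡ; map-++; map-const; map-id; tabulate-∘; take++drop≡id; toList-∷ʳ; zipWith-++; zipWith-assoc; zipWith-comm; zipWith-idem; zipWith-identityʳ; zipWith-identityˡ; ≡-dec)
open import Data.Vec.Relation.Unary.All using (All; []; _∷_; all?)
open import Defs
open import Function.Base using (_∘_; id)
open import Level using (0ℓ)
open import Relation.Binary.PropositionalEquality
open import Relation.Binary.PropositionalEquality.Algebra using (isMagma)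
open import Relation.Nullary using (Dec; contradiction; does; yes; no)
open import Relation.Nullary.Decidable using (from-no)
open import Relation.Unary using (Pred; _∈_; _∉_; _⊆_; _≐_; _∩_; _∪_)

import Algebra.Properties.CommutativeSemigroup as CommutativeSemigroupProperties

private
  variable
    m n k : ℕ
    A : Set

-- Linear algebra over F₂

open CommutativeSemigroupProperties
  (CommutativeMonoid.commutativeSemigroup (CommutativeRing.+-commutativeMonoid xor-∧-commutativeRing))
  using () renaming (interchange to xor-interchange)

⊕-assoc : (u v w : Word n) → (u ⊕ v) ⊕ w ≡ u ⊕ (v ⊕ w)
⊕-assoc = zipWith-assoc xor-assoc

⊕-comm : (u v : Word n) → u ⊕ v ≡ v ⊕ u
⊕-comm = zipWith-comm xor-comm

⊕-identityˡ : (v : Word n) → 𝟎 ⊕ v ≡ v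
⊕-identityˡ = zipWith-identityˡ xor-identityˡ

⊕-identityʳ : (v : Word n) → v ⊕ 𝟎 ≡ v
⊕-identityʳ = zipWith-identityʳ xor-identityʳ

⊕-self : (v : Word n) → v ⊕ v ≡ 𝟎
⊕-self []      = refl
⊕-self (a ∷ v) = cong₂ _∷_ (xor-same a) (⊕-self v)

⊕-commutativeSemigroup : ℕ → CommutativeSemigroup 0ℓ 0ℓ
⊕-commutativeSemigroup n = record
  { Carrier = Word n
  ; _∙_ = _⊕_
  ; isCommutativeSemigroup = record
    { isSemigroup = record { isMagma = isMagma _⊕_ ; assoc = ⊕-assoc }
    ; comm = ⊕-comm
    }
  }

⊕-interchange : (u v w z : Word n) → (u ⊕ v) ⊕ (w ⊕ z) ≡ (u ⊕ w) ⊕ (v ⊕ z)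
⊕-interchange {n} = CommutativeSemigroupProperties.interchange (⊕-commutativeSemigroup n)

⊕-cancel : (u v : Word n) → u ⊕ (u ⊕ v) ≡ v
⊕-cancel u v = begin
  u ⊕ (u ⊕ v)  ≡⟨ ⊕-assoc u u v ⟨
  (u ⊕ u) ⊕ v  ≡⟨ cong (_⊕ v) (⊕-self u) ⟩
  𝟎 ⊕ v        ≡⟨ ⊕-identityˡ v ⟩
  v            ∎
  where open ≡-Reasoning

⊕-cancelMiddle : (u v w : Word n) → (u ⊕ v) ⊕ (v ⊕ w) ≡ u ⊕ w
⊕-cancelMiddle u v w = trans (⊕-assoc u v (v ⊕ w)) (cong (u ⊕_) (⊕-cancel v w))

⊕-injectiveˡ : (u : Word n) {v w : Word n} → u ⊕ v ≡ u ⊕ w → v ≡ w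
⊕-injectiveˡ u {v} {w} eq = trans (sym (⊕-cancel u v)) (trans (cong (u ⊕_) eq) (⊕-cancel u w))

⊕≡𝟎⇒≡ : {u v : Word n} → u ⊕ v ≡ 𝟎 → u ≡ v
⊕≡𝟎⇒≡ {u = u} {v} eq = sym (⊕-injectiveˡ u (trans eq (sym (⊕-self u))))

1₂•-identity : (v : Word n) → 1₂ • v ≡ v
1₂•-identity = map-id

0₂•-zero : (v : Word n) → 0₂ • v ≡ 𝟎
0₂•-zero v = map-const v 0₂

•-distribʳ-xor : (a b : F₂) (v : Word n) → (a xor b) • v ≡ a • v ⊕ b • v
•-distribʳ-xor a b []      = refl
•-distribʳ-xor a b (c ∷ v) = cong₂ _∷_ (∧-distribʳ-xor c a b) (•-distribʳ-xor a b v)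

·-comm : (u v : Word n) → u · v ≡ v · u
·-comm u v = cong (foldr′ _xor_ 0₂) (zipWith-comm ∧-comm u v)

·-zeroˡ : (v : Word n) → 𝟎 · v ≡ 0₂
·-zeroˡ []      = refl
·-zeroˡ (a ∷ v) = ·-zeroˡ v

·-distribʳ : (w u v : Word n) → (u ⊕ v) · w ≡ (u · w) xor (v · w)
·-distribʳ []      []      []      = refl
·-distribʳ (c ∷ w) (a ∷ u) (b ∷ v) = trans
  (cong₂ _xor_ (∧-distribʳ-xor c a b) (·-distribʳ w u v))
  (xor-interchange (a ∧ c) (b ∧ c) (u · w) (v · w))

·-distribˡ : (w u v : Word n) → w · (u ⊕ v) ≡ (w · u) xor (w · v)
·-distribˡ w u v = trans (·-comm w (u ⊕ v))
  (trans (·-distribʳ w u v) (cong₂ _xor_ (·-comm u w) (·-comm v w)))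

•-·-assoc : (a : F₂) (u v : Word n) → (a • u) · v ≡ a ∧ (u · v)
•-·-assoc 0₂ u v = trans (cong (_· v) (0₂•-zero u)) (·-zeroˡ v)
•-·-assoc 1₂ u v = cong (_· v) (1₂•-identity u)

++-· : (u v : Word m) (w z : Word n) → (u ++ w) · (v ++ z) ≡ (u · v) xor (w · z)
++-· []      []      w z = refl
++-· (a ∷ u) (b ∷ v) w z = trans (cong ((a ∧ b) xor_) (++-· u v w z))
  (sym (xor-assoc (a ∧ b) (u · v) (w · z)))

·-nondegenerate : (v : Word n) → (∀ u → u · v ≡ 0₂) → v ≡ 𝟎
·-nondegenerate []      h = refl
·-nondegenerate (a ∷ v) h = cong₂ _∷_ a≡0 (·-nondegenerate v (λ u → h (0₂ ∷ u)))
  where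
  a≡0 : a ≡ 0₂
  a≡0 = trans (sym (xor-identityʳ a)) (trans (cong (a xor_) (sym (·-zeroˡ v))) (h (1₂ ∷ 𝟎)))

-- Additive maps and linear combinations

Additive : (Word m → Word n) → Set
Additive f = ∀ u v → f (u ⊕ v) ≡ f u ⊕ f v

module _ {f : Word m → Word n} (f-additive : Additive f) where

  additive-𝟎 : f 𝟎 ≡ 𝟎
  additive-𝟎 = begin
    f 𝟎        ≡⟨ cong f (⊕-self 𝟎) ⟨
    f (𝟎 ⊕ 𝟎)  ≡⟨ f-additive 𝟎 𝟎 ⟩
    f 𝟎 ⊕ f 𝟎  ≡⟨ ⊕-self (f 𝟎) ⟩
    𝟎          ∎
    where open ≡-Reasoning

  additive-• : ∀ a v → f (a • v) ≡ a • f v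
  additive-• 0₂ v = trans (cong f (0₂•-zero v)) (trans additive-𝟎 (sym (0₂•-zero (f v))))
  additive-• 1₂ v = trans (cong f (1₂•-identity v)) (sym (1₂•-identity (f v)))

  additive-linearCombination : (as : Word k) (vs : Vec (Word m) k) →
    f (linearCombination as vs) ≡ linearCombination as (map f vs)
  additive-linearCombination []       []       = additive-𝟎
  additive-linearCombination (a ∷ as) (v ∷ vs) = trans
    (f-additive (a • v) (linearCombination as vs))
    (cong₂ _⊕_ (additive-• a v) (additive-linearCombination as vs))

linearCombination-additive : (vs : Vec (Word n) k) → Additive (λ as → linearCombination as vs)
linearCombination-additive []       []       []       = sym (⊕-self 𝟎)
linearCombination-additive (v ∷ vs) (a ∷ as) (b ∷ bs) = trans
  (cong₂ _⊕_ (•-distribʳ-xor a b v) (linearCombination-additive vs as bs))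
  (⊕-interchange (a • v) (b • v) (linearCombination as vs) (linearCombination bs vs))

linearCombination-0₂∷ : (as : Word k) (v : Word n) (vs : Vec (Word n) k) →
  linearCombination (0₂ ∷ as) (v ∷ vs) ≡ linearCombination as vs
linearCombination-0₂∷ as v vs = trans (cong (_⊕ _) (0₂•-zero v)) (⊕-identityˡ _)

linearCombination-1₂∷ : (as : Word k) (v : Word n) (vs : Vec (Word n) k) →
  linearCombination (1₂ ∷ as) (v ∷ vs) ≡ v ⊕ linearCombination as vs
linearCombination-1₂∷ as v vs = cong (_⊕ _) (1₂•-identity v)

linearCombination-· : (as : Word k) (vs : Vec (Word n) k) (w : Word n) →
  linearCombination as vs · w ≡ as · map (_· w) vs
linearCombination-· []       []       w = ·-zeroˡ w
linearCombination-· (a ∷ as) (v ∷ vs) w = trans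
  (·-distribʳ w (a • v) (linearCombination as vs))
  (cong₂ _xor_ (•-·-assoc a v w) (linearCombination-· as vs w))

•-++ : (a : F₂) (u : Word m) (v : Word n) → a • (u ++ v) ≡ (a • u) ++ (a • v)
•-++ a u v = map-++ (a ∧_) u v

𝟎-++ : ∀ m {n} → 𝟎 {m} ++ 𝟎 {n} ≡ 𝟎
𝟎-++ zero    = refl
𝟎-++ (suc m) = cong (0₂ ∷_) (𝟎-++ m)

linearCombination-++ : (as : Word k) (us : Vec (Word m) k) (vs : Vec (Word n) k) →
  linearCombination as (zipWith _++_ us vs) ≡ linearCombination as us ++ linearCombination as vs
linearCombination-++ {m = m} [] [] [] = sym (𝟎-++ m)
linearCombination-++ (a ∷ as) (u ∷ us) (v ∷ vs) = trans
  (cong₂ _⊕_ (•-++ a u v) (linearCombination-++ as us vs))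
  (zipWith-++ _xor_ (a • u) (a • v) _ _)

linearCombination-map-0₂∷ : (as : Word k) (vs : Vec (Word n) k) →
  linearCombination as (map (0₂ ∷_) vs) ≡ 0₂ ∷ linearCombination as vs
linearCombination-map-0₂∷ as vs = sym (additive-linearCombination (λ _ _ → refl) as vs)

linearCombination-identityMatrix : (as : Word n) → linearCombination as (identityMatrix n) ≡ as
linearCombination-identityMatrix [] = refl
linearCombination-identityMatrix {suc n} (a ∷ as) = begin
  a • e₀ ⊕ linearCombination as (tabulate (λ i → 0₂ ∷ row i))
    ≡⟨ cong₂ (λ e vs → a • (1₂ ∷ e) ⊕ linearCombination as vs)
         (tabulate-const n) (tabulate-∘ (0₂ ∷_) row) ⟩
  a • (1₂ ∷ 𝟎) ⊕ linearCombination as (map (0₂ ∷_) (identityMatrix n))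
    ≡⟨ cong₂ _⊕_ (cong₂ _∷_ (∧-identityʳ a) (a•𝟎 a)) (linearCombination-map-0₂∷ as (identityMatrix n)) ⟩
  (a xor 0₂) ∷ (𝟎 ⊕ linearCombination as (identityMatrix n))
    ≡⟨ cong₂ _∷_ (xor-identityʳ a) (trans (⊕-identityˡ _) (linearCombination-identityMatrix as)) ⟩
  a ∷ as ∎
  where
  open ≡-Reasoning
  row : Fin n → Word n
  row i = tabulate λ j → does (toℕ i ≟ toℕ j)
  e₀ : Word (suc n)
  e₀ = 1₂ ∷ tabulate {n = n} (λ _ → 0₂)
  tabulate-const : ∀ n → tabulate {n = n} (λ _ → 0₂) ≡ 𝟎
  tabulate-const zero = refl
  tabulate-const (suc n) = cong (0₂ ∷_) (tabulate-const n)
  a•𝟎 : ∀ a → a • 𝟎 {n} ≡ 𝟎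
  a•𝟎 0₂ = 0₂•-zero 𝟎
  a•𝟎 1₂ = 1₂•-identity 𝟎

-- Over `F₂` additive maps are linear and the unit vectors span, so equality of two such maps
-- becomes one equation between matrices, which evaluation can decide.
additive-ext : {f g : Word m → Word n} → Additive f → Additive g →
  map f (identityMatrix m) ≡ map g (identityMatrix m) → ∀ v → f v ≡ g v
additive-ext {m = m} {f = f} {g} f-additive g-additive eq v = begin
  f v                                          ≡⟨ cong f (linearCombination-identityMatrix v) ⟨
  f (linearCombination v (identityMatrix m))   ≡⟨ additive-linearCombination f-additive v _ ⟩
  linearCombination v (map f (identityMatrix m)) ≡⟨ cong (linearCombination v) eq ⟩
  linearCombination v (map g (identityMatrix m)) ≡⟨ additive-linearCombination g-additive v _ ⟨
  g (linearCombination v (identityMatrix m))   ≡⟨ cong g (linearCombination-identityMatrix v) ⟩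
  g v                                          ∎
  where open ≡-Reasoning

dual-isSubspace : (C : Pred (Word n) 0ℓ) → IsSubspace (dual C)
dual-isSubspace C = record
  { 𝟎-closed = λ {c} _ → ·-zeroˡ c
  ; ⊕-closed = λ {u} {v} u⊥C v⊥C {c} c∈C →
      trans (·-distribʳ c u v) (cong₂ _xor_ (u⊥C c∈C) (v⊥C c∈C))
  }

-- Weights

weight-++ : (u : Word m) (v : Word n) → weight (u ++ v) ≡ weight u + weight v
weight-++ []       v = refl
weight-++ (0₂ ∷ u) v = weight-++ u v
weight-++ (1₂ ∷ u) v = cong suc (weight-++ u v)

weight≡0⇒≡𝟎 : (v : Word n) → weight v ≡ 0 → v ≡ 𝟎
weight≡0⇒≡𝟎 []       _  = refl
weight≡0⇒≡𝟎 (0₂ ∷ v) eq = cong (0₂ ∷_) (weight≡0⇒≡𝟎 v eq)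

weight-𝟎 : ∀ n → weight (𝟎 {n}) ≡ 0
weight-𝟎 zero    = refl
weight-𝟎 (suc n) = weight-𝟎 n

-- Coordinates where both words are 1 count twice on the right and vanish from the sum; the
-- correction stands on the left to avoid truncated subtraction.
weight-⊕ : (u v : Word n) → weight (u ⊕ v) + 2 * weight (zipWith _∧_ u v) ≡ weight u + weight v
weight-⊕ []       []       = refl
weight-⊕ (0₂ ∷ u) (0₂ ∷ v) = weight-⊕ u v
weight-⊕ (0₂ ∷ u) (1₂ ∷ v) = trans (cong suc (weight-⊕ u v)) (sym (+-suc (weight u) (weight v)))
weight-⊕ (1₂ ∷ u) (0₂ ∷ v) = cong suc (weight-⊕ u v)
weight-⊕ (1₂ ∷ u) (1₂ ∷ v) = begin
  weight (u ⊕ v) + 2 * suc c      ≡⟨ lemma (weight (u ⊕ v)) c ⟩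
  2 + (weight (u ⊕ v) + 2 * c)    ≡⟨ cong (2 +_) (weight-⊕ u v) ⟩
  2 + (weight u + weight v)       ≡⟨ cong suc (+-suc (weight u) (weight v)) ⟨
  suc (weight u + suc (weight v)) ∎
  where
  open ≡-Reasoning
  c : ℕ
  c = weight (zipWith _∧_ u v)
  lemma : ∀ a b → a + 2 * suc b ≡ 2 + (a + 2 * b)
  lemma = solve-∀

sum≡0⇒2∣weight : (v : Word n) → foldr′ _xor_ 0₂ v ≡ 0₂ → 2 ∣ weight v
sum≡1⇒2∣1+weight : (v : Word n) → foldr′ _xor_ 0₂ v ≡ 1₂ → 2 ∣ suc (weight v)

sum≡0⇒2∣weight []       _  = 2 ∣0
sum≡0⇒2∣weight (0₂ ∷ v) eq = sum≡0⇒2∣weight v eq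
sum≡0⇒2∣weight (1₂ ∷ v) eq = sum≡1⇒2∣1+weight v (not-injective eq)

sum≡1⇒2∣1+weight (0₂ ∷ v) eq = sum≡1⇒2∣1+weight v eq
sum≡1⇒2∣1+weight (1₂ ∷ v) eq = ∣m∣n⇒∣m+n ∣-refl (sum≡0⇒2∣weight v (not-injective eq))

selfOrthogonal⇒2∣weight : (v : Word n) → v · v ≡ 0₂ → 2 ∣ weight v
selfOrthogonal⇒2∣weight v eq = subst (2 ∣_) (cong weight (zipWith-idem ∧-idem v))
  (sum≡0⇒2∣weight (zipWith _∧_ v v) eq)

-- Orthogonal words overlap in an even number of coordinates, so twice the overlap is a multiple of
-- 4.
orthogonal⇒weight-⊕ : (u v : Word n) → u · v ≡ 0₂ →
  ∃[ q ] weight (u ⊕ v) + 4 * q ≡ weight u + weight v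
orthogonal⇒weight-⊕ u v u⊥v with sum≡0⇒2∣weight (zipWith _∧_ u v) u⊥v
... | divides q eq = q , trans (cong (weight (u ⊕ v) +_) lemma) (weight-⊕ u v)
  where
  regroup : ∀ q → 4 * q ≡ 2 * (q * 2)
  regroup = solve-∀
  lemma : 4 * q ≡ 2 * weight (zipWith _∧_ u v)
  lemma = trans (regroup q) (cong (2 *_) (sym eq))

4∣weight-⊕ : {u v : Word n} → u · v ≡ 0₂ → 4 ∣ weight u → 4 ∣ weight v → 4 ∣ weight (u ⊕ v)
4∣weight-⊕ {u = u} {v} u⊥v 4∣u 4∣v with orthogonal⇒weight-⊕ u v u⊥v
... | q , eq = ∣m+n∣m⇒∣n
  (subst (4 ∣_) (trans (sym eq) (+-comm (weight (u ⊕ v)) (4 * q))) (∣m∣n⇒∣m+n 4∣u 4∣v)) (m∣m*n q)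

-- The code C(x)

module _ {C : Pred (Word n) 0ℓ} (C-selfDual : SelfDual C) where

  selfDual⇒isSubspace : IsSubspace C
  selfDual⇒isSubspace = record
    { 𝟎-closed = proj₂ C-selfDual λ {c} → 𝟎-closed {c}
    ; ⊕-closed = λ {u} {v} u∈C v∈C → proj₂ C-selfDual λ {c} →
        ⊕-closed {u} {v} (λ {c} → proj₁ C-selfDual u∈C {c}) (λ {c} → proj₁ C-selfDual v∈C {c}) {c}
    }
    where open IsSubspace (dual-isSubspace C)

-- The codeword `g` is not orthogonal to `x`, so `C⁰` has index two in `C` and `g` represents the
-- other coset.
module GluedCode {C : Pred (Word n) 0ℓ} (C-selfDual : SelfDual C) (x : Word n)
  {g : Word n} (g∈C : g ∈ C) (g·x≡1 : g · x ≡ 1₂) where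

  open IsSubspace (selfDual⇒isSubspace C-selfDual)

  C⁰ : Pred (Word n) 0ℓ
  C⁰ = orthogonalSubcode C x

  C-orthogonal : ∀ {u v} → u ∈ C → v ∈ C → u · v ≡ 0₂
  C-orthogonal u∈C v∈C = proj₁ C-selfDual u∈C v∈C

  -- A coset of `C⁰` inside `y + C`, labelled by an inner product with `x` instead of a
  -- representative, so that for fixed `y` it has only one label.
  Layer : Word n → F₂ → Pred (Word n) 0ℓ
  Layer y β w = ∃[ c ] c ∈ C × c · x ≡ β × w ≡ y ⊕ c

  representative : ∀ β → ∃[ c ] c ∈ C × c · x ≡ β
  representative 0₂ = 𝟎 , 𝟎-closed , ·-zeroˡ x
  representative 1₂ = g , g∈C , g·x≡1

  coset≐layer : ∀ {y c β} → c ∈ C → c · x ≡ β → translate (y ⊕ c) C⁰ ≐ Layer y β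
  coset≐layer {y} {c} {β} c∈C c·x≡β = to , from
    where
    to : translate (y ⊕ c) C⁰ ⊆ Layer y β
    to (s , (s∈C , s⊥x) , refl) = c ⊕ s , ⊕-closed c∈C s∈C
      , trans (·-distribʳ x c s) (trans (cong₂ _xor_ c·x≡β s⊥x) (xor-identityʳ β))
      , ⊕-assoc y c s
    from : Layer y β ⊆ translate (y ⊕ c) C⁰
    from (d , d∈C , d·x≡β , refl) = c ⊕ d
      , (⊕-closed c∈C d∈C , trans (·-distribʳ x c d) (trans (cong₂ _xor_ c·x≡β d·x≡β) (xor-same β)))
      , sym (⊕-cancelMiddle y c d)

  -- Since `𝟎` lies in `C⁰`, the representative `u` lies in `S`, hence is `y ⊕ c` with `c` in `C`;
  -- the label is then `c · x`.
  coset⇒layer : ∀ {S : Pred (Word n) 0ℓ} {y} → S IsCosetOf C⁰ → S ⊆ translate y C → ∃[ β ] S ≐ Layer y β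
  coset⇒layer {S} {y} (u , S⊆u+C⁰ , u+C⁰⊆S) S⊆y+C
    with S⊆y+C (u+C⁰⊆S (𝟎 , (𝟎-closed , ·-zeroˡ x) , sym (⊕-identityʳ u)))
  ... | c , c∈C , refl = c · x
      , proj₁ (coset≐layer c∈C refl) ∘ S⊆u+C⁰
      , u+C⁰⊆S ∘ proj₂ (coset≐layer c∈C refl)

  -- Some codeword has label `not β`; its translate is covered but cannot lie in `S`, so it lies in
  -- `S′` and determines the label there.
  complementaryLayers : ∀ {S S′ : Pred (Word n) 0ℓ} {y β β′} → S ⊆ Layer y β → S′ ⊆ Layer y β′ →
    translate y C ⊆ S ∪ S′ → β′ ≡ not β
  complementaryLayers {y = y} {β} {β′} S⊆ S′⊆ cover with representative (not β)
  ... | c , c∈C , c·x≡notβ with cover (c , c∈C , refl)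
  ... | inj₁ c∈S with S⊆ c∈S
  ...   | d , _ , d·x≡β , y+c≡y+d = contradiction
          (trans (sym d·x≡β) (trans (cong (_· x) (sym (⊕-injectiveˡ y y+c≡y+d))) c·x≡notβ))
          (not-¬ refl)
  complementaryLayers {y = y} {β} {β′} S⊆ S′⊆ cover | c , c∈C , c·x≡notβ | inj₂ c∈S′ with S′⊆ c∈S′
  ... | d , _ , d·x≡β′ , y+c≡y+d =
        trans (sym d·x≡β′) (trans (cong (_· x) (sym (⊕-injectiveˡ y y+c≡y+d))) c·x≡notβ)

  ∈C-decompose : C ⊆ C⁰ ∪ translate g C⁰
  ∈C-decompose {c} c∈C = split (c · x) refl
    where
    split : ∀ β → c · x ≡ β → c ∈ C⁰ ∪ translate g C⁰
    split 0₂ c⊥x   = inj₁ (c∈C , c⊥x)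
    split 1₂ c·x≡1 = inj₂ (g ⊕ c
      , (⊕-closed g∈C c∈C , trans (·-distribʳ x g c) (cong₂ _xor_ g·x≡1 c·x≡1))
      , sym (⊕-cancel g c))

  -- `C` consists of `C⁰` and `g + C⁰`, so orthogonality to `C⁰` and to `g` gives orthogonality to
  -- `C`, and self-duality applies.
  dual-C⁰⇒∈C : ∀ {w} → w ∈ dual C⁰ → w · g ≡ 0₂ → w ∈ C
  dual-C⁰⇒∈C {w} w⊥C⁰ w⊥g = proj₂ C-selfDual λ {c} c∈C → w⊥ (∈C-decompose c∈C)
    where
    w⊥ : ∀ {c} → c ∈ C⁰ ∪ translate g C⁰ → w · c ≡ 0₂
    w⊥ (inj₁ c∈C⁰) = w⊥C⁰ c∈C⁰
    w⊥ (inj₂ (s , s∈C⁰ , refl)) = trans (·-distribˡ w g s) (cong₂ _xor_ w⊥g (w⊥C⁰ s∈C⁰))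

  x∈dual-C⁰ : x ∈ dual C⁰
  x∈dual-C⁰ {c} (_ , c⊥x) = trans (·-comm x c) c⊥x

  extension : 8 ∣ n → (∀ {c} → c ∈ C → weight c % 4 ≡ 0) → weight x % 2 ≡ 1 → Extension C x
  extension 8∣n C-doublyEven x-odd = record
    { 8∣n = 8∣n
    ; doublyEvenSelfDual = record { selfDual = C-selfDual ; doublyEven = C-doublyEven }
    ; oddWeight = x-odd
    ; C¹ = translate x C⁰
    ; C² = translate g C⁰
    ; C³ = translate (x ⊕ g) C⁰
    ; C¹-coset = x , id , id
    ; C²-coset = g , id , id
    ; C³-coset = x ⊕ g , id , id
    ; dual-C⁰ = decompose , λ w∈ {c} → compose w∈ {c}
    ; C-union = ∈C-decompose , λ { (inj₁ (c∈C , _)) → c∈C ; (inj₂ (s , (s∈C , _) , refl)) → ⊕-closed g∈C s∈C }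
    ; x+C-union = (λ { (c , c∈C , refl) → x+decompose (∈C-decompose c∈C) })
        , λ { (inj₁ (s , (s∈C , _) , refl)) → s , s∈C , refl
            ; (inj₂ (s , (s∈C , _) , refl)) → g ⊕ s , ⊕-closed g∈C s∈C , ⊕-assoc x g s }
    }
    where
    x+decompose : ∀ {c} → c ∈ C⁰ ∪ translate g C⁰ → x ⊕ c ∈ translate x C⁰ ∪ translate (x ⊕ g) C⁰
    x+decompose (inj₁ c∈C⁰)              = inj₁ (_ , c∈C⁰ , refl)
    x+decompose (inj₂ (s , s∈C⁰ , refl)) = inj₂ (s , s∈C⁰ , sym (⊕-assoc x g s))

    decompose : dual C⁰ ⊆ C⁰ ∪ translate x C⁰ ∪ translate g C⁰ ∪ translate (x ⊕ g) C⁰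
    decompose {w} w⊥C⁰ with w · g in w·g≡
    ... | 0₂ with ∈C-decompose (dual-C⁰⇒∈C (λ {c} → w⊥C⁰ {c}) w·g≡)
    ...   | inj₁ w∈C⁰ = inj₁ w∈C⁰
    ...   | inj₂ w∈C² = inj₂ (inj₂ (inj₁ w∈C²))
    -- As `x · g` is 1, adding `x` makes `w` orthogonal to `g`; so `x ⊕ w` is in `C` and `w` in
    -- `x + C`.
    decompose {w} w⊥C⁰ | 1₂
      with x+decompose (∈C-decompose (dual-C⁰⇒∈C {x ⊕ w}
             (λ {c} c∈C⁰ → trans (·-distribʳ c x w) (cong₂ _xor_ (x∈dual-C⁰ c∈C⁰) (w⊥C⁰ c∈C⁰)))
             (trans (·-distribʳ g x w) (cong₂ _xor_ (trans (·-comm x g) g·x≡1) w·g≡))))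
    ... | inj₁ w∈ = inj₂ (inj₁ (subst (_∈ translate x C⁰) (⊕-cancel x w) w∈))
    ... | inj₂ w∈ = inj₂ (inj₂ (inj₂ (subst (_∈ translate (x ⊕ g) C⁰) (⊕-cancel x w) w∈)))

    g∈dual-C⁰ : g ∈ dual C⁰
    g∈dual-C⁰ (c∈C , _) = C-orthogonal g∈C c∈C

    C⁰⊆dual-C⁰ : C⁰ ⊆ dual C⁰
    C⁰⊆dual-C⁰ (s∈C , _) (c∈C , _) = C-orthogonal s∈C c∈C

    open IsSubspace (dual-isSubspace C⁰) using () renaming (⊕-closed to dual-⊕-closed)

    translate⊆dual-C⁰ : ∀ {u} → u ∈ dual C⁰ → translate u C⁰ ⊆ dual C⁰
    translate⊆dual-C⁰ {u} u∈ (s , s∈C⁰ , refl) {c} =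
      dual-⊕-closed {u} {s} (λ {c} → u∈ {c}) (λ {c} → C⁰⊆dual-C⁰ s∈C⁰ {c}) {c}

    compose : C⁰ ∪ translate x C⁰ ∪ translate g C⁰ ∪ translate (x ⊕ g) C⁰ ⊆ dual C⁰
    compose (inj₁ w∈) {c} = C⁰⊆dual-C⁰ w∈ {c}
    compose (inj₂ (inj₁ w∈)) {c} = translate⊆dual-C⁰ (λ {c} → x∈dual-C⁰ {c}) w∈ {c}
    compose (inj₂ (inj₂ (inj₁ w∈))) {c} = translate⊆dual-C⁰ (λ {c} → g∈dual-C⁰ {c}) w∈ {c}
    compose (inj₂ (inj₂ (inj₂ w∈))) {c} =
      translate⊆dual-C⁰ (λ {c} → dual-⊕-closed {x} {g} (λ {c} → x∈dual-C⁰ {c}) (λ {c} → g∈dual-C⁰ {c}) {c}) w∈ {c}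

  -- The code C(x) in glued form

  glue : Word n → Word (2 + n)
  glue c = c · x ∷ c · x ∷ c

  -- The bit `b` records which coset in `x + C` is called `C¹`: it is the label of `C¹`, and `x`
  -- itself is preceded by 1, 0 if `b` is 0 and by 0, 1 otherwise.
  apex : F₂ → Word (2 + n)
  apex b = not b ∷ b ∷ x

  Glued : F₂ → Pred (Word (2 + n)) 0ℓ
  Glued b v = ∃[ ε ] ∃[ c ] c ∈ C × v ≡ ε • apex b ⊕ glue c

  glue-additive : Additive glue
  glue-additive u v = cong (λ a → a ∷ a ∷ u ⊕ v) (·-distribʳ x u v)

  glue-𝟎 : glue 𝟎 ≡ 𝟎
  glue-𝟎 = cong (λ a → a ∷ a ∷ 𝟎) (·-zeroˡ x)

  0₂•apex : ∀ b c → 0₂ • apex b ⊕ glue c ≡ glue c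
  0₂•apex b c = trans (cong (_⊕ glue c) (0₂•-zero (apex b))) (⊕-identityˡ (glue c))

  1₂•apex : ∀ b c → 1₂ • apex b ⊕ glue c ≡ (not b xor c · x) ∷ (b xor c · x) ∷ x ⊕ c
  1₂•apex b c = cong (_⊕ glue c) (1₂•-identity (apex b))

  Layers : F₂ → Pred (Word (2 + n)) 0ℓ
  Layers b = prepend 0₂ 0₂ (Layer 𝟎 0₂) ∪ prepend 1₂ 1₂ (Layer 𝟎 1₂)
           ∪ prepend 1₂ 0₂ (Layer x b) ∪ prepend 0₂ 1₂ (Layer x (not b))

  layers≐glued : ∀ b → Layers b ≐ Glued b
  layers≐glued b = to , from
    where
    unlift : ∀ {c} β → c · x ≡ β → β ∷ β ∷ (𝟎 ⊕ c) ≡ 0₂ • apex b ⊕ glue c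
    unlift {c} β refl = trans (cong (λ w → c · x ∷ c · x ∷ w) (⊕-identityˡ c)) (sym (0₂•apex b c))

    to : Layers b ⊆ Glued b
    to (inj₁ (_ , (c , c∈C , c·x≡ , refl) , refl)) = 0₂ , c , c∈C , unlift 0₂ c·x≡
    to (inj₂ (inj₁ (_ , (c , c∈C , c·x≡ , refl) , refl))) = 0₂ , c , c∈C , unlift 1₂ c·x≡
    to (inj₂ (inj₂ (inj₁ (_ , (c , c∈C , refl , refl) , refl)))) = 1₂ , c , c∈C
      , sym (trans (1₂•apex (c · x) c)
          (cong₂ (λ p q → p ∷ q ∷ x ⊕ c) (xor-inverseˡ (c · x)) (xor-same (c · x))))
    to (inj₂ (inj₂ (inj₂ (_ , (c , c∈C , c·x≡ , refl) , refl)))) = 1₂ , c , c∈C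
      , sym (trans (1₂•apex b c) (cong₂ (λ p q → p ∷ q ∷ x ⊕ c)
          (trans (cong (not b xor_) c·x≡) (xor-same (not b)))
          (trans (cong (b xor_) c·x≡) (xor-inverseʳ b))))

    glued∈ : ∀ {c} → c ∈ C → ∀ β → c · x ≡ β → Layers b (glue c)
    glued∈ {c} c∈C 0₂ eq = inj₁ (c , (c , c∈C , eq , sym (⊕-identityˡ c)) , cong (λ a → a ∷ a ∷ c) eq)
    glued∈ {c} c∈C 1₂ eq = inj₂ (inj₁ (c , (c , c∈C , eq , sym (⊕-identityˡ c)) , cong (λ a → a ∷ a ∷ c) eq))

    shifted∈ : ∀ {c} → c ∈ C → ∀ b β → c · x ≡ β → Layers b ((not b xor c · x) ∷ (b xor c · x) ∷ x ⊕ c)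
    shifted∈ {c} c∈C 0₂ 0₂ eq rewrite eq = inj₂ (inj₂ (inj₁ (x ⊕ c , (c , c∈C , eq , refl) , refl)))
    shifted∈ {c} c∈C 1₂ 1₂ eq rewrite eq = inj₂ (inj₂ (inj₁ (x ⊕ c , (c , c∈C , eq , refl) , refl)))
    shifted∈ {c} c∈C 0₂ 1₂ eq rewrite eq = inj₂ (inj₂ (inj₂ (x ⊕ c , (c , c∈C , eq , refl) , refl)))
    shifted∈ {c} c∈C 1₂ 0₂ eq rewrite eq = inj₂ (inj₂ (inj₂ (x ⊕ c , (c , c∈C , eq , refl) , refl)))

    from : Glued b ⊆ Layers b
    from (0₂ , c , c∈C , refl) = subst (Layers b) (sym (0₂•apex b c)) (glued∈ c∈C (c · x) refl)
    from (1₂ , c , c∈C , refl) = subst (Layers b) (sym (1₂•apex b c)) (shifted∈ c∈C b (c · x) refl)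

  prepend-mono : ∀ {a b} {S S′ : Pred (Word n) 0ℓ} → S ⊆ S′ → prepend a b S ⊆ prepend a b S′
  prepend-mono S⊆S′ (c , c∈S , eq) = c , S⊆S′ c∈S , eq

  -- `C¹` is a coset inside `x + C`, hence a layer with some label `b`; the covering conditions then
  -- force the labels of `C²` and `C³`.
  code≐layers : (E : Extension C x) → ∃[ b ] Extension.code E ≐ Layers b
  code≐layers E = b , to , from
    where
    open Extension E using (C¹; C²; C³; C¹-coset; C²-coset; C³-coset; C-union; x+C-union; code)

    C⊆𝟎+C : C ⊆ translate 𝟎 C
    C⊆𝟎+C {c} c∈C = c , c∈C , sym (⊕-identityˡ c)

    C⁰≐ : C⁰ ≐ Layer 𝟎 0₂
    C⁰≐ = (λ { {c} (c∈C , c⊥x) → c , c∈C , c⊥x , sym (⊕-identityˡ c) })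
        , (λ { (c , c∈C , c⊥x , refl) → subst C⁰ (sym (⊕-identityˡ c)) (c∈C , c⊥x) })

    layer¹ : ∃[ β ] C¹ ≐ Layer x β
    layer¹ = coset⇒layer C¹-coset (proj₂ x+C-union ∘ inj₁)

    b : F₂
    b = proj₁ layer¹

    C¹≐ : C¹ ≐ Layer x b
    C¹≐ = proj₂ layer¹

    C²≐ : C² ≐ Layer 𝟎 1₂
    C²≐ with coset⇒layer C²-coset (C⊆𝟎+C ∘ proj₂ C-union ∘ inj₂)
    ... | β , C²≐β = subst (λ β → C² ≐ Layer 𝟎 β)
      (complementaryLayers (proj₁ C⁰≐) (proj₁ C²≐β)
        (λ { (c , c∈C , refl) → proj₁ C-union (subst C (sym (⊕-identityˡ c)) c∈C) }))
      C²≐β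

    C³≐ : C³ ≐ Layer x (not b)
    C³≐ with coset⇒layer C³-coset (proj₂ x+C-union ∘ inj₂)
    ... | β , C³≐β = subst (λ β → C³ ≐ Layer x β)
      (complementaryLayers (proj₁ C¹≐) (proj₁ C³≐β) (proj₁ x+C-union)) C³≐β

    to : code ⊆ Layers b
    to (inj₁ v∈)               = inj₁ (prepend-mono (proj₁ C⁰≐) v∈)
    to (inj₂ (inj₁ v∈))        = inj₂ (inj₁ (prepend-mono (proj₁ C²≐) v∈))
    to (inj₂ (inj₂ (inj₁ v∈))) = inj₂ (inj₂ (inj₁ (prepend-mono (proj₁ C¹≐) v∈)))
    to (inj₂ (inj₂ (inj₂ v∈))) = inj₂ (inj₂ (inj₂ (prepend-mono (proj₁ C³≐) v∈)))

    from : Layers b ⊆ code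
    from (inj₁ v∈)               = inj₁ (prepend-mono (proj₂ C⁰≐) v∈)
    from (inj₂ (inj₁ v∈))        = inj₂ (inj₁ (prepend-mono (proj₂ C²≐) v∈))
    from (inj₂ (inj₂ (inj₁ v∈))) = inj₂ (inj₂ (inj₁ (prepend-mono (proj₂ C¹≐) v∈)))
    from (inj₂ (inj₂ (inj₂ v∈))) = inj₂ (inj₂ (inj₂ (prepend-mono (proj₂ C³≐) v∈)))

  code≐glued : (E : Extension C x) → ∃[ b ] Extension.code E ≐ Glued b
  code≐glued E with code≐layers E
  ... | b , to , from = b , proj₁ (layers≐glued b) ∘ to , from ∘ proj₂ (layers≐glued b)

  -- Self-duality, dimension, minimum weight and shadow of the glued code

  module Properties {D : Pred (Word (2 + n)) 0ℓ} {b : F₂} (D≐glued : D ≐ Glued b) (weight-x : weight x ≡ 13) where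

    x·x≡1 : x · x ≡ 1₂
    x·x≡1 = ¬-not λ x⊥x → from-no (2 ∣? 13) (subst (2 ∣_) weight-x (selfOrthogonal⇒2∣weight x x⊥x))

    apex∈D : apex b ∈ D
    apex∈D = proj₂ D≐glued (1₂ , 𝟎 , 𝟎-closed , sym (begin
      1₂ • apex b ⊕ glue 𝟎  ≡⟨ cong₂ _⊕_ (1₂•-identity (apex b)) (glue-𝟎) ⟩
      apex b ⊕ 𝟎            ≡⟨ ⊕-identityʳ (apex b) ⟩
      apex b                ∎))
      where open ≡-Reasoning

    glue∈D : ∀ {c} → c ∈ C → glue c ∈ D
    glue∈D {c} c∈C = proj₂ D≐glued (0₂ , c , c∈C , sym (0₂•apex b c))

    D-isSubspace : IsSubspace D
    D-isSubspace = record
      { 𝟎-closed = subst D (glue-𝟎) (glue∈D 𝟎-closed)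
      ; ⊕-closed = λ u∈D v∈D → proj₂ D≐glued (sum∈ (proj₁ D≐glued u∈D) (proj₁ D≐glued v∈D))
      }
      where
      sum∈ : ∀ {u v} → u ∈ Glued b → v ∈ Glued b → u ⊕ v ∈ Glued b
      sum∈ (ε , c , c∈C , refl) (ζ , d , d∈C , refl) = ε xor ζ , c ⊕ d , ⊕-closed c∈C d∈C , trans
        (⊕-interchange (ε • apex b) (glue c) (ζ • apex b) (glue d))
        (sym (cong₂ _⊕_ (•-distribʳ-xor ε ζ (apex b)) (glue-additive c d)))

    -- The first two entries of the apex are complementary, so exactly one of them contributes `p`.
    apex-·-diagonal : ∀ p w → apex b · (p ∷ p ∷ w) ≡ p xor (x · w)
    apex-·-diagonal p w = lemma b p (x · w)
      where
      lemma : ∀ b p a → (not b ∧ p) xor ((b ∧ p) xor a) ≡ p xor a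
      lemma 0₂ p  a = refl
      lemma 1₂ p  a = refl

    diagonal-·-glue : ∀ p w c → (p ∷ p ∷ w) · glue c ≡ w · c
    diagonal-·-glue p w c = begin
      q xor (q xor (w · c))  ≡⟨ xor-assoc q q (w · c) ⟨
      (q xor q) xor (w · c)  ≡⟨ cong (_xor (w · c)) (xor-same q) ⟩
      w · c                  ∎
      where
      open ≡-Reasoning
      q : F₂
      q = p ∧ (c · x)

    apex⊥apex : apex b · apex b ≡ 0₂
    apex⊥apex = lemma b x·x≡1
      where
      lemma : ∀ b {a} → a ≡ 1₂ → (not b ∧ not b) xor ((b ∧ b) xor a) ≡ 0₂
      lemma 0₂ refl = refl
      lemma 1₂ refl = refl

    apex⊥glue : ∀ c → apex b · glue c ≡ 0₂
    apex⊥glue c = trans (apex-·-diagonal (c · x) c)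
      (trans (cong ((c · x) xor_) (·-comm x c)) (xor-same (c · x)))

    D⊥apex : ∀ {v} → v ∈ D → v · apex b ≡ 0₂
    D⊥apex v∈D with proj₁ D≐glued v∈D
    ... | ε , c , c∈C , refl = trans (·-distribʳ (apex b) (ε • apex b) (glue c)) (cong₂ _xor_
      (trans (•-·-assoc ε (apex b) (apex b)) (trans (cong (ε ∧_) apex⊥apex) (∧-zeroʳ ε)))
      (trans (·-comm (glue c) (apex b)) (apex⊥glue c)))

    D⊥glue : ∀ {v d} → v ∈ D → d ∈ C → v · glue d ≡ 0₂
    D⊥glue {d = d} v∈D d∈C with proj₁ D≐glued v∈D
    ... | ε , c , c∈C , refl = trans (·-distribʳ (glue d) (ε • apex b) (glue c)) (cong₂ _xor_
      (trans (•-·-assoc ε (apex b) (glue d)) (trans (cong (ε ∧_) (apex⊥glue d)) (∧-zeroʳ ε)))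
      (trans (diagonal-·-glue (c · x) c d) (C-orthogonal c∈C d∈C)))

    D-orthogonal : D ⊆ dual D
    D-orthogonal {u} u∈D v∈D with proj₁ D≐glued v∈D
    ... | ε , c , c∈C , refl = trans (·-distribˡ u (ε • apex b) (glue c)) (cong₂ _xor_
      (begin
        u · (ε • apex b)    ≡⟨ ·-comm u (ε • apex b) ⟩
        (ε • apex b) · u    ≡⟨ •-·-assoc ε (apex b) u ⟩
        ε ∧ (apex b · u)    ≡⟨ cong (ε ∧_) (trans (·-comm (apex b) u) (D⊥apex u∈D)) ⟩
        ε ∧ 0₂              ≡⟨ ∧-zeroʳ ε ⟩
        0₂                  ∎)
      (D⊥glue u∈D c∈C))
      where open ≡-Reasoning

    dual⊆D : dual D ⊆ D
    dual⊆D {p ∷ q ∷ w} v⊥D = proj₂ D≐glued (ε , w′ , w′∈C , (begin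
      p ∷ q ∷ w                             ≡⟨ ⊕-cancel (ε • apex b) (p ∷ q ∷ w) ⟨
      ε • apex b ⊕ (p′ ∷ q′ ∷ w′)           ≡⟨ cong (λ a → ε • apex b ⊕ (p′ ∷ a ∷ w′)) p′≡q′ ⟨
      ε • apex b ⊕ (p′ ∷ p′ ∷ w′)           ≡⟨ cong (λ a → ε • apex b ⊕ (a ∷ a ∷ w′)) p′≡w′·x ⟩
      ε • apex b ⊕ glue w′                  ∎))
      where
      open ≡-Reasoning
      ε p′ q′ : F₂
      -- This choice makes the first two coordinates of `ε • apex b ⊕ (p ∷ q ∷ w)` equal. Testing
      -- against `glue c` then puts `w′` in `C`, and testing against the apex gives `p′ ≡ w′ · x`.
      ε = p xor q
      p′ = (ε ∧ not b) xor p
      q′ = (ε ∧ b) xor q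
      w′ : Word n
      w′ = ε • x ⊕ w

      p′≡q′ : p′ ≡ q′
      p′≡q′ = lemma p q b
        where
        lemma : ∀ p q b → (((p xor q) ∧ not b) xor p) ≡ (((p xor q) ∧ b) xor q)
        lemma 0₂ 0₂ b  = refl
        lemma 0₂ 1₂ 0₂ = refl
        lemma 0₂ 1₂ 1₂ = refl
        lemma 1₂ 0₂ 0₂ = refl
        lemma 1₂ 0₂ 1₂ = refl
        lemma 1₂ 1₂ b  = refl

      diagonal⊥ : ∀ {u} → u ∈ D → apex b · u ≡ 0₂ → (p′ ∷ p′ ∷ w′) · u ≡ 0₂
      diagonal⊥ {u} u∈D apex⊥u = begin
        (p′ ∷ p′ ∷ w′) · u                         ≡⟨ cong (λ a → (p′ ∷ a ∷ w′) · u) p′≡q′ ⟩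
        (ε • apex b ⊕ (p ∷ q ∷ w)) · u             ≡⟨ ·-distribʳ u (ε • apex b) (p ∷ q ∷ w) ⟩
        ((ε • apex b) · u) xor ((p ∷ q ∷ w) · u)   ≡⟨ cong₂ _xor_ (•-·-assoc ε (apex b) u) (v⊥D u∈D) ⟩
        (ε ∧ (apex b · u)) xor 0₂                  ≡⟨ cong (λ a → (ε ∧ a) xor 0₂) apex⊥u ⟩
        (ε ∧ 0₂) xor 0₂                            ≡⟨ cong (_xor 0₂) (∧-zeroʳ ε) ⟩
        0₂                                         ∎

      w′∈C : w′ ∈ C
      w′∈C = proj₂ C-selfDual λ {c} c∈C →
        trans (sym (diagonal-·-glue p′ w′ c)) (diagonal⊥ (glue∈D c∈C) (apex⊥glue c))

      p′≡w′·x : p′ ≡ w′ · x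
      p′≡w′·x = xor≡0⇒≡ p′ (w′ · x) (begin
        p′ xor (w′ · x)           ≡⟨ cong (p′ xor_) (·-comm w′ x) ⟩
        p′ xor (x · w′)           ≡⟨ apex-·-diagonal p′ w′ ⟨
        apex b · (p′ ∷ p′ ∷ w′)   ≡⟨ ·-comm (apex b) (p′ ∷ p′ ∷ w′) ⟩
        (p′ ∷ p′ ∷ w′) · apex b   ≡⟨ diagonal⊥ apex∈D apex⊥apex ⟩
        0₂                        ∎)
        where
        xor≡0⇒≡ : ∀ a b → a xor b ≡ 0₂ → a ≡ b
        xor≡0⇒≡ 0₂ 0₂ _ = refl
        xor≡0⇒≡ 1₂ 1₂ _ = refl

    D-selfDual : SelfDual D
    D-selfDual = (λ u∈D {v} → D-orthogonal u∈D {v}) , dual⊆D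

    weight-apex : weight (apex b) ≡ 14
    weight-apex = lemma b
      where
      lemma : ∀ b → weight (apex b) ≡ 14
      lemma 0₂ = cong suc weight-x
      lemma 1₂ = cong suc weight-x

    D-singlyEven : SinglyEvenSelfDual D
    D-singlyEven = record
      { selfDual = D-selfDual
      ; singlyEven = apex b , apex∈D , cong (_% 4) weight-apex
      }

    -- The apex has different first two entries while glued words have equal ones, so it is
    -- independent of the glued basis of `C`.
    D-hasDimension : (vs : Vec (Word n) k) → LinearlyIndependent vs → span vs ≐ C → HasDimension D (suc k)
    D-hasDimension {k} vs vs-independent span≐C = basis , independent , to , from
      where
      basis : Vec (Word (2 + n)) (suc k)
      basis = apex b ∷ map glue vs

      combination : ∀ ε as →
        linearCombination (ε ∷ as) basis ≡ ε • apex b ⊕ glue (linearCombination as vs)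
      combination ε as = cong (ε • apex b ⊕_) (sym (additive-linearCombination {f = glue} glue-additive as vs))

      independent : LinearlyIndependent basis
      independent (0₂ ∷ as) eq = cong (0₂ ∷_) (vs-independent as (cong (tail ∘ tail)
        (trans (sym (0₂•apex b _)) (trans (sym (combination 0₂ as)) eq))))
      independent (1₂ ∷ as) eq = contradiction
        (trans (sym (1₂•apex b (linearCombination as vs))) (trans (sym (combination 1₂ as)) eq))
        (lemma b (linearCombination as vs · x))
        where
        lemma : ∀ b a {w} → (not b xor a) ∷ (b xor a) ∷ w ≢ 𝟎 {2 + n}
        lemma 0₂ 0₂ ()
        lemma 0₂ 1₂ ()
        lemma 1₂ 0₂ ()
        lemma 1₂ 1₂ ()

      to : span basis ⊆ D
      to (ε ∷ as , refl) = proj₂ D≐glued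
        (ε , linearCombination as vs , proj₁ span≐C (as , refl) , combination ε as)

      from : D ⊆ span basis
      from v∈D with proj₁ D≐glued v∈D
      ... | ε , c , c∈C , refl with proj₂ span≐C c∈C
      ...   | as , refl = ε ∷ as , combination ε as

    weight-1₂•apex : ∀ c → weight (1₂ • apex b ⊕ glue c) ≡ suc (weight (x ⊕ c))
    weight-1₂•apex c = trans (cong weight (1₂•apex b c)) (lemma b (c · x))
      where
      lemma : ∀ b a → weight ((not b xor a) ∷ (b xor a) ∷ x ⊕ c) ≡ suc (weight (x ⊕ c))
      lemma 0₂ 0₂ = refl
      lemma 0₂ 1₂ = refl
      lemma 1₂ 0₂ = refl
      lemma 1₂ 1₂ = refl

    weight≤weight-glue : ∀ c → weight c ≤ weight (glue c)
    weight≤weight-glue c = lemma (c · x)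
      where
      lemma : ∀ a → weight c ≤ weight (a ∷ a ∷ c)
      lemma 0₂ = ≤-refl
      lemma 1₂ = m≤n+m (weight c) 2

    D-minimumWeight : (∀ {c} → c ∈ C → c ≢ 𝟎 → 13 ≤ weight c) →
      (∀ {c} → c ∈ C → 12 ≤ weight (x ⊕ c)) → MinimumWeight D 14
    D-minimumWeight C-bound coset-bound =
        (apex b , (apex∈D , apex≢𝟎) , weight-apex)
      , λ { {v} (v∈D , v≢𝟎) → ≤∧≢⇒< (bound v∈D v≢𝟎)
            (λ 13≡w → from-no (2 ∣? 13) (subst (2 ∣_) (sym 13≡w)
              (selfOrthogonal⇒2∣weight v (D-orthogonal v∈D v∈D)))) }
      where
      apex≢𝟎 : apex b ≢ 𝟎
      apex≢𝟎 eq = contradiction (trans (sym weight-apex) (trans (cong weight eq) (weight-𝟎 (2 + n)))) λ ()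

      bound : ∀ {v} → v ∈ D → v ≢ 𝟎 → 13 ≤ weight v
      bound v∈D v≢𝟎 with proj₁ D≐glued v∈D
      -- Exactly one of the first two coordinates is 1, which raises the coset bound 12 to 13.
      ... | 1₂ , c , c∈C , refl = subst (13 ≤_) (sym (weight-1₂•apex c)) (s≤s (coset-bound c∈C))
      ... | 0₂ , c , c∈C , refl = subst (λ v → 13 ≤ weight v) (sym (0₂•apex b c))
        (≤-trans (C-bound c∈C c≢𝟎) (weight≤weight-glue c))
        where
        c≢𝟎 : c ≢ 𝟎
        c≢𝟎 refl = v≢𝟎 (trans (0₂•apex b 𝟎) (glue-𝟎))

    -- The zero word lies in `D`, so shadow words have positive weight. The word `z` has odd weight,
    -- hence is outside `D`, and its product with a word of `D` is `ε xor (c · x)`, which vanishes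
    -- when the weight of that word is divisible by 4.
    D-shadow : (∀ {c} → c ∈ C → weight c % 4 ≡ 0) → LeastWeight (shadow D) 1
    D-shadow C-doublyEven = (z , ((λ {v} → z⊥D₀ {v}) , z∉D) , weight-z) , λ { {v} (_ , v∉D) →
        n≢0⇒n>0 λ w≡0 → v∉D (subst D (sym (weight≡0⇒≡𝟎 v w≡0)) (IsSubspace.𝟎-closed D-isSubspace)) }
      where
      z : Word (2 + n)
      z = not b ∷ b ∷ 𝟎

      weight-z : weight z ≡ 1
      weight-z = lemma b
        where
        lemma : ∀ b → weight (not b ∷ b ∷ 𝟎 {n}) ≡ 1
        lemma 0₂ = cong suc (weight-𝟎 n)
        lemma 1₂ = cong suc (weight-𝟎 n)

      z∉D : z ∉ D
      z∉D z∈D = from-no (2 ∣? 1) (subst (2 ∣_) weight-z (selfOrthogonal⇒2∣weight z (D-orthogonal z∈D z∈D)))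

      z·apex : z · apex b ≡ 1₂
      z·apex = lemma b (·-zeroˡ x)
        where
        lemma : ∀ b {a} → a ≡ 0₂ → (not b ∧ not b) xor ((b ∧ b) xor a) ≡ 1₂
        lemma 0₂ refl = refl
        lemma 1₂ refl = refl

      z·glue : ∀ c → z · glue c ≡ c · x
      z·glue c = lemma b (c · x) (·-zeroˡ c)
        where
        lemma : ∀ b a {a′} → a′ ≡ 0₂ → (not b ∧ a) xor ((b ∧ a) xor a′) ≡ a
        lemma 0₂ a refl = xor-identityʳ a
        lemma 1₂ a refl = xor-identityʳ a

      4∣C : ∀ {c} → c ∈ C → 4 ∣ weight c
      4∣C {c} c∈C = m%n≡0⇒n∣m (weight c) 4 (C-doublyEven c∈C)

      -- If `ε` is 0 and `c · x` is 1, the weight is 2 more than a multiple of 4. If `ε` is 1 and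
      -- `c · x` is 0, adding the orthogonal word `glue c`, of weight divisible by 4, would make the
      -- apex weight 14 divisible by 4.
      agree : ∀ ε {c} → c ∈ C → ∀ a → c · x ≡ a → 4 ∣ weight (ε • apex b ⊕ glue c) → ε ≡ a
      agree 0₂ c∈C 0₂ _ _ = refl
      agree 1₂ c∈C 1₂ _ _ = refl
      agree 0₂ {c} c∈C 1₂ c·x≡1 4∣w = contradiction
        (∣m+n∣m⇒∣n (subst (4 ∣_) (trans (cong weight (trans (0₂•apex b c) (cong (λ a → a ∷ a ∷ c) c·x≡1)))
          (+-comm 2 (weight c))) 4∣w) (4∣C c∈C))
        (from-no (4 ∣? 2))
      agree 1₂ {c} c∈C 0₂ c⊥x 4∣w = contradiction
        (subst (4 ∣_) (trans (cong weight sum≡apex) weight-apex)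
          (4∣weight-⊕ {u = glue c} {apex b ⊕ glue c} (trans (·-comm (glue c) (apex b ⊕ glue c)) (trans (·-distribʳ (glue c) (apex b) (glue c))
             (cong₂ _xor_ (apex⊥glue c) (trans (diagonal-·-glue (c · x) c c) (C-orthogonal c∈C c∈C)))))
             (subst (4 ∣_) (cong (λ a → weight (a ∷ a ∷ c)) (sym c⊥x)) (4∣C c∈C))
             (subst (λ v → 4 ∣ weight (v ⊕ glue c)) (1₂•-identity (apex b)) 4∣w)))
        (from-no (4 ∣? 14))
        where
        sum≡apex : glue c ⊕ (apex b ⊕ glue c) ≡ apex b
        sum≡apex = trans (cong (glue c ⊕_) (⊕-comm (apex b) (glue c))) (⊕-cancel (glue c) (apex b))

      z⊥D₀ : z ∈ dual (D ∩ λ v → weight v % 4 ≡ 0)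
      z⊥D₀ {v} (v∈D , w%4≡0) with proj₁ D≐glued v∈D
      ... | ε , c , c∈C , refl = begin
        z · (ε • apex b ⊕ glue c)               ≡⟨ ·-distribˡ z (ε • apex b) (glue c) ⟩
        (z · (ε • apex b)) xor (z · glue c)     ≡⟨ cong₂ _xor_ z·ε•apex (z·glue c) ⟩
        ε xor (c · x)                           ≡⟨ cong (_xor (c · x)) ε≡c·x ⟩
        (c · x) xor (c · x)                     ≡⟨ xor-same (c · x) ⟩
        0₂                                      ∎
        where
        open ≡-Reasoning
        ε≡c·x : ε ≡ c · x
        ε≡c·x = agree ε c∈C (c · x) refl (m%n≡0⇒n∣m _ 4 w%4≡0)
        z·ε•apex : z · (ε • apex b) ≡ ε
        z·ε•apex = begin
          z · (ε • apex b)   ≡⟨ ·-comm z (ε • apex b) ⟩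
          (ε • apex b) · z   ≡⟨ •-·-assoc ε (apex b) z ⟩
          ε ∧ (apex b · z)   ≡⟨ cong (ε ∧_) (trans (·-comm (apex b) z) z·apex) ⟩
          ε ∧ 1₂             ≡⟨ ∧-identityʳ ε ⟩
          ε                  ∎

-- Exhaustive search for light words

-- Each difference uses up one unit of `t`; evaluation stops at the first difference beyond these
-- and never forms the sum.
heavierSum : ℕ → Word m → Word m → Bool
heavierSum t       []       []       = false
heavierSum t       (0₂ ∷ u) (0₂ ∷ v) = heavierSum t u v
heavierSum t       (1₂ ∷ u) (1₂ ∷ v) = heavierSum t u v
heavierSum zero    (0₂ ∷ u) (1₂ ∷ v) = true
heavierSum zero    (1₂ ∷ u) (0₂ ∷ v) = true
heavierSum (suc t) (0₂ ∷ u) (1₂ ∷ v) = heavierSum t u v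
heavierSum (suc t) (1₂ ∷ u) (0₂ ∷ v) = heavierSum t u v

heavierSum-sound : ∀ t (u v : Word m) → heavierSum t u v ≡ true → t < weight (u ⊕ v)
heavierSum-sound t       []       []       ()
heavierSum-sound t       (0₂ ∷ u) (0₂ ∷ v) h = heavierSum-sound t u v h
heavierSum-sound t       (1₂ ∷ u) (1₂ ∷ v) h = heavierSum-sound t u v h
heavierSum-sound zero    (0₂ ∷ u) (1₂ ∷ v) h = s≤s z≤n
heavierSum-sound zero    (1₂ ∷ u) (0₂ ∷ v) h = s≤s z≤n
heavierSum-sound (suc t) (0₂ ∷ u) (1₂ ∷ v) h = s≤s (heavierSum-sound t u v h)
heavierSum-sound (suc t) (1₂ ∷ u) (0₂ ∷ v) h = s≤s (heavierSum-sound t u v h)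

-- d is the number of vectors of the list that may still be added to y, and t
-- the weight to be exceeded by the sum and the number of vectors added.
search : ℕ → ℕ → Word m → Vec (Word m) k → Bool
search d             t y []       = heavierSum t 𝟎 y
search zero          t y (v ∷ vs) = heavierSum t 𝟎 y
search (suc zero)    t y (v ∷ vs) = heavierSum (pred t) v y ∧ search 1 t y vs
search (suc (suc d)) t y (v ∷ vs) = search (suc d) (pred t) (v ⊕ y) vs ∧ search (suc (suc d)) t y vs

-- `as` stands for one half of a word and the shifted combination for the other, so it is the weight
-- of the whole word that is bounded.
Exceeds : ℕ → ℕ → Word m → Vec (Word m) k → Set
Exceeds d t y vs = ∀ as → weight as ≤ d → t < weight as + weight (linearCombination as vs ⊕ y)

exceeds-[] : ∀ {d t} (y : Word m) → t < weight y → Exceeds d t y []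
exceeds-[] y t<y [] _ = subst (_ <_) (cong weight (sym (⊕-identityˡ y))) t<y

exceeds-zero : ∀ {t} (y : Word m) (vs : Vec (Word m) k) → t < weight y → Exceeds 0 t y vs
exceeds-zero {k = k} {t} y vs t<y as w≤0 =
  subst (λ as → t < weight as + weight (linearCombination as vs ⊕ y))
    (sym (weight≡0⇒≡𝟎 as (n≤0⇒n≡0 w≤0)))
    (subst (t <_) (sym (cong₂ _+_ (weight-𝟎 k) (cong weight (trans
      (cong (_⊕ y) (additive-𝟎 (linearCombination-additive vs))) (⊕-identityˡ y))))) t<y)

exceeds-∷ : ∀ {d t} (y v : Word m) (vs : Vec (Word m) k) →
  Exceeds d (pred t) (v ⊕ y) vs → Exceeds (suc d) t y vs → Exceeds (suc d) t y (v ∷ vs)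
exceeds-∷ {t = t} y v vs with-v without-v (0₂ ∷ as) w≤d =
  subst (λ u → t < weight as + weight (u ⊕ y)) (sym (linearCombination-0₂∷ as v vs)) (without-v as w≤d)
exceeds-∷ {t = t} y v vs with-v without-v (1₂ ∷ as) (s≤s w≤d) =
  -- The coefficient of `v` adds one to the weight, which makes up for `pred t`, also when `t` is 0.
  subst (λ u → t < suc (weight as + weight u)) sum≡ (s≤s (≤-trans (n≤1+pred t) (with-v as w≤d)))
  where
  n≤1+pred : ∀ n → n ≤ suc (pred n)
  n≤1+pred zero    = z≤n
  n≤1+pred (suc n) = s≤s ≤-refl

  sum≡ : linearCombination as vs ⊕ (v ⊕ y) ≡ linearCombination (1₂ ∷ as) (v ∷ vs) ⊕ y
  sum≡ = begin
    linearCombination as vs ⊕ (v ⊕ y)         ≡⟨ ⊕-assoc (linearCombination as vs) v y ⟨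
    (linearCombination as vs ⊕ v) ⊕ y         ≡⟨ cong (_⊕ y) (⊕-comm (linearCombination as vs) v) ⟩
    (v ⊕ linearCombination as vs) ⊕ y         ≡⟨ cong (_⊕ y) (linearCombination-1₂∷ as v vs) ⟨
    linearCombination (1₂ ∷ as) (v ∷ vs) ⊕ y  ∎
    where open ≡-Reasoning

heavierSum-𝟎-sound : ∀ t (y : Word m) → heavierSum t 𝟎 y ≡ true → t < weight y
heavierSum-𝟎-sound t y h = subst (t <_) (cong weight (⊕-identityˡ y)) (heavierSum-sound t 𝟎 y h)

search-sound : ∀ d t (y : Word m) (vs : Vec (Word m) k) → search d t y vs ≡ true → Exceeds d t y vs
search-sound d t y [] h = exceeds-[] y (heavierSum-𝟎-sound t y h)
search-sound zero t y vs@(_ ∷ _) h = exceeds-zero y vs (heavierSum-𝟎-sound t y h)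
-- After `v` no further vector may be added, so a single comparison of `v` with `y` settles that
-- branch.
search-sound (suc zero) t y (v ∷ vs) h = exceeds-∷ y v vs
  (exceeds-zero (v ⊕ y) vs (heavierSum-sound (pred t) v y (∧-conicalˡ _ _ h))) (search-sound 1 t y vs (∧-conicalʳ _ _ h))
search-sound (suc (suc d)) t y (v ∷ vs) h = exceeds-∷ y v vs
  (search-sound (suc d) (pred t) (v ⊕ y) vs (∧-conicalˡ _ _ h)) (search-sound (suc (suc d)) t y vs (∧-conicalʳ _ _ h))

-- Cyclic rotation

rotate : Vec A n → Vec A n
rotate []       = []
rotate (a ∷ as) = as ∷ʳ a

weight-∷ʳ : ∀ a (v : Word n) → weight (v ∷ʳ a) ≡ weight (a ∷ v)
weight-∷ʳ a  []       = refl
weight-∷ʳ a  (0₂ ∷ v) = trans (weight-∷ʳ a v) (lemma a)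
  where
  lemma : ∀ a → weight (a ∷ v) ≡ weight (a ∷ 0₂ ∷ v)
  lemma 0₂ = refl
  lemma 1₂ = refl
weight-∷ʳ a  (1₂ ∷ v) = trans (cong suc (weight-∷ʳ a v)) (lemma a)
  where
  lemma : ∀ a → suc (weight (a ∷ v)) ≡ weight (a ∷ 1₂ ∷ v)
  lemma 0₂ = refl
  lemma 1₂ = refl

weight-rotate : (v : Word n) → weight (rotate v) ≡ weight v
weight-rotate []      = refl
weight-rotate (a ∷ v) = weight-∷ʳ a v

∷ʳ-⊕ : ∀ a b (u v : Word n) → (u ∷ʳ a) ⊕ (v ∷ʳ b) ≡ (u ⊕ v) ∷ʳ (a xor b)
∷ʳ-⊕ a b []      []      = refl
∷ʳ-⊕ a b (c ∷ u) (d ∷ v) = cong ((c xor d) ∷_) (∷ʳ-⊕ a b u v)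

rotate-additive : Additive (rotate {n = n})
rotate-additive []      []      = refl
rotate-additive (a ∷ u) (b ∷ v) = sym (∷ʳ-⊕ a b u v)

-- The head corresponds to the border and stays in place; the tail corresponds to the circulant
-- block.
rotateTail : Word (suc n) → Word (suc n)
rotateTail (a ∷ v) = a ∷ rotate v

rotateTail-additive : Additive (rotateTail {n})
rotateTail-additive (a ∷ u) (b ∷ v) = cong ((a xor b) ∷_) (rotate-additive u v)

weight-rotateTail : (v : Word (suc n)) → weight (rotateTail v) ≡ weight v
weight-rotateTail (0₂ ∷ v) = weight-rotate v
weight-rotateTail (1₂ ∷ v) = cong suc (weight-rotate v)

-- A nonzero word becomes, after finitely many rotations, one that begins with 1₂.
rotation-induction : (P : Word (suc n) → Set) → (∀ v → P (rotate v) → P v) →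
  P 𝟎 → (∀ v → P (1₂ ∷ v)) → ∀ v → P v
rotation-induction {n} P P-rotate P-𝟎 P-1₂∷ v = go (toList v) 0 v (sym (List.++-identityʳ (toList v)))
  where
  zeros : ∀ {m} k (v : Word m) → toList v ≡ List.replicate k 0₂ → v ≡ 𝟎
  zeros zero    []      _  = refl
  zeros (suc k) (a ∷ v) eq = cong₂ _∷_ (∷-injectiveˡ eq) (zeros k v (∷-injectiveʳ eq))

  replicate-∷ʳ : ∀ k → List.replicate k 0₂ List.++ List.[ 0₂ ] ≡ List.replicate (suc k) 0₂
  replicate-∷ʳ zero    = refl
  replicate-∷ʳ (suc k) = cong (0₂ ∷_) (replicate-∷ʳ k)

  -- The entries `as` are still to be inspected and the `k` zeros have been moved to the end; the
  -- recursion is on `as`.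
  go : ∀ as k (v : Word (suc n)) → toList v ≡ as List.++ List.replicate k 0₂ → P v
  go []        k v       eq = subst P (sym (zeros k v eq)) P-𝟎
  go (1₂ ∷ as) k (a ∷ v) eq = subst (λ a → P (a ∷ v)) (sym (∷-injectiveˡ eq)) (P-1₂∷ v)
  go (0₂ ∷ as) k (a ∷ v) eq = P-rotate (a ∷ v) (go as (suc k) (v ∷ʳ a) (begin
    toList (v ∷ʳ a)                                       ≡⟨ toList-∷ʳ a v ⟩
    toList v List.++ List.[ a ]                           ≡⟨ cong₂ (λ bs b → bs List.++ List.[ b ]) (∷-injectiveʳ eq) (∷-injectiveˡ eq) ⟩
    (as List.++ List.replicate k 0₂) List.++ List.[ 0₂ ]  ≡⟨ ++-assoc as (List.replicate k 0₂) List.[ 0₂ ] ⟩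
    as List.++ (List.replicate k 0₂ List.++ List.[ 0₂ ])  ≡⟨ cong (as List.++_) (replicate-∷ʳ k) ⟩
    as List.++ List.replicate (suc k) 0₂                  ∎))
    where open ≡-Reasoning

searchRotated : ℕ → ℕ → Vec (Word (2 + n)) (2 + n) → Bool
searchRotated d t (v₀ ∷ v₁ ∷ vs) = heavierSum t 𝟎 v₀ ∧ search d (pred t) v₁ (v₀ ∷ vs)

-- Up to rotation the tail of as is zero or begins with 1₂; in the latter
-- case v₁ occurs in the combination, which leaves one row less to search.
searchRotated-sound : ∀ d t (M : Vec (Word (2 + n)) (2 + n)) →
  (∀ as → linearCombination (rotateTail as) M ≡ rotateTail (linearCombination as M)) →
  searchRotated d t M ≡ true →
  ∀ as → weight as ≤ suc d → weight as + weight (linearCombination as M) ≤ t → as ≡ 𝟎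
searchRotated-sound {n} d t (v₀ ∷ v₁ ∷ vs) rotate-comm found (a ∷ v) w≤d light = weight≡0⇒≡𝟎 (a ∷ v)
  (rotation-induction Light⇒0 Light⇒0-rotate Light⇒0-𝟎 Light⇒0-1₂∷ v a w≤d light)
  where
  encode : Word (2 + n) → Word (2 + n)
  encode as = linearCombination as (v₀ ∷ v₁ ∷ vs)

  v₀-heavy : t < weight v₀
  v₀-heavy = heavierSum-𝟎-sound t v₀ (∧-conicalˡ _ _ found)

  -- The head is quantified inside, since only the tail is rotated, and the conclusion is about the
  -- weight, which rotation preserves.
  Light⇒0 : Word (suc n) → Set
  Light⇒0 v = ∀ a → weight (a ∷ v) ≤ suc d → weight (a ∷ v) + weight (encode (a ∷ v)) ≤ t → weight (a ∷ v) ≡ 0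

  Light⇒0-rotate : ∀ v → Light⇒0 (rotate v) → Light⇒0 v
  Light⇒0-rotate v h a w≤d light = trans (sym w≡)
    (h a (subst (_≤ suc d) (sym w≡) w≤d)
      (subst₂ (λ p q → p + q ≤ t) (sym w≡)
        (sym (trans (cong weight (rotate-comm (a ∷ v))) (weight-rotateTail (encode (a ∷ v))))) light))
    where
    w≡ : weight (a ∷ rotate v) ≡ weight (a ∷ v)
    w≡ = weight-rotateTail (a ∷ v)

  Light⇒0-𝟎 : Light⇒0 𝟎
  Light⇒0-𝟎 0₂ _ _     = weight-𝟎 n
  -- Here the combination is the single row `v₀`, already heavier than `t` on its own.
  Light⇒0-𝟎 1₂ _ light = contradiction
    (≤-trans (≤-trans (≤-reflexive (cong weight (sym encode≡v₀))) (m≤n+m (weight (encode (1₂ ∷ 𝟎))) _)) light)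
    (<⇒≱ v₀-heavy)
    where
    encode≡v₀ : encode (1₂ ∷ 𝟎) ≡ v₀
    encode≡v₀ = trans (linearCombination-1₂∷ 𝟎 v₀ (v₁ ∷ vs))
      (trans (cong (v₀ ⊕_) (additive-𝟎 (linearCombination-additive (v₁ ∷ vs)))) (⊕-identityʳ v₀))

  Light⇒0-1₂∷ : ∀ v → Light⇒0 (1₂ ∷ v)
  -- As `v₁` occurs, it is the starting word of the search; its coefficient accounts for the drop
  -- from `suc d` to `d` and from `t` to `pred t`.
  Light⇒0-1₂∷ v a w≤d light = contradiction light (<⇒≱ (subst₂ (λ p q → t < p + weight q) (sym (w≡ a)) swap
    (<-≤-trans′ (search-sound d (pred t) v₁ (v₀ ∷ vs) (∧-conicalʳ _ _ found) (a ∷ v) (≤-pred (subst (_≤ suc d) (w≡ a) w≤d))))))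
    where
    w≡ : ∀ a → weight (a ∷ 1₂ ∷ v) ≡ suc (weight (a ∷ v))
    w≡ 0₂ = refl
    w≡ 1₂ = refl

    <-≤-trans′ : ∀ {t s} → pred t < s → t < suc s
    <-≤-trans′ {zero}  _   = s≤s z≤n
    <-≤-trans′ {suc t} t<s = s≤s t<s

    swap : linearCombination (a ∷ v) (v₀ ∷ vs) ⊕ v₁ ≡ encode (a ∷ 1₂ ∷ v)
    swap = begin
      (a • v₀ ⊕ linearCombination v vs) ⊕ v₁  ≡⟨ ⊕-assoc (a • v₀) _ v₁ ⟩
      a • v₀ ⊕ (linearCombination v vs ⊕ v₁)  ≡⟨ cong (a • v₀ ⊕_) (⊕-comm _ v₁) ⟩
      a • v₀ ⊕ (v₁ ⊕ linearCombination v vs)  ≡⟨ cong (a • v₀ ⊕_) (linearCombination-1₂∷ v v₁ vs) ⟨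
      encode (a ∷ 1₂ ∷ v)                     ∎
      where open ≡-Reasoning

-- Expresses the second half `w ⊕ f v` of a coset word through its first half `u ⊕ v`. The offset
-- `f u ⊕ w` depends on the translating word only, so a search can range over light first halves.
translate-additive : {f : Word m → Word n} → Additive f → ∀ u v w → f (u ⊕ v) ⊕ (f u ⊕ w) ≡ w ⊕ f v
translate-additive {f = f} f-additive u v w = begin
  f (u ⊕ v) ⊕ (f u ⊕ w)    ≡⟨ cong (_⊕ (f u ⊕ w)) (trans (f-additive u v) (⊕-comm (f u) (f v))) ⟩
  (f v ⊕ f u) ⊕ (f u ⊕ w)  ≡⟨ ⊕-cancelMiddle (f v) (f u) w ⟩
  f v ⊕ w                  ≡⟨ ⊕-comm (f v) w ⟩
  w ⊕ f v                  ∎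
  where open ≡-Reasoning

-- Induction on the rows. Orthogonality is assumed for all combinations: leading zeros pass it on to
-- the tail, and `v` is orthogonal to every combination of the tail.
4∣weight-linearCombination : (vs : Vec (Word n) k) →
  (∀ as bs → linearCombination as vs · linearCombination bs vs ≡ 0₂) →
  All (λ v → 4 ∣ weight v) vs → ∀ as → 4 ∣ weight (linearCombination as vs)
4∣weight-linearCombination {n} [] _ [] [] = subst (4 ∣_) (sym (weight-𝟎 n)) (4 ∣0)
4∣weight-linearCombination (v ∷ vs) orthogonal (4∣v ∷ 4∣vs) (a ∷ as) = lemma a
  where
  4∣tail : 4 ∣ weight (linearCombination as vs)
  4∣tail = 4∣weight-linearCombination vs (λ as bs → trans
    (sym (cong₂ _·_ (linearCombination-0₂∷ as v vs) (linearCombination-0₂∷ bs v vs)))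
    (orthogonal (0₂ ∷ as) (0₂ ∷ bs))) 4∣vs as

  v⊥tail : v · linearCombination as vs ≡ 0₂
  v⊥tail = trans (sym (cong₂ _·_
    (trans (linearCombination-1₂∷ 𝟎 v vs)
      (trans (cong (v ⊕_) (additive-𝟎 (linearCombination-additive vs))) (⊕-identityʳ v)))
    (linearCombination-0₂∷ as v vs))) (orthogonal (1₂ ∷ 𝟎) (0₂ ∷ as))

  lemma : ∀ a → 4 ∣ weight (linearCombination (a ∷ as) (v ∷ vs))
  lemma 0₂ = subst (λ u → 4 ∣ weight u) (sym (linearCombination-0₂∷ as v vs)) 4∣tail
  lemma 1₂ = subst (λ u → 4 ∣ weight u) (sym (linearCombination-1₂∷ as v vs))
    (4∣weight-⊕ {u = v} {linearCombination as vs} v⊥tail 4∣v 4∣tail)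

-- If both failed, the sum would be at least `p + q + 2`.
≤-pigeonhole : ∀ p q {a b} → a + b ≤ suc (p + q) → a ≤ p ⊎ b ≤ q
≤-pigeonhole p q {a} {b} a+b≤ with a ≤? p
... | yes a≤p = inj₁ a≤p
... | no  a≰p = inj₂ (+-cancelˡ-≤ (suc p) b q (≤-trans (+-monoˡ-≤ b (≰⇒> a≰p)) a+b≤))

-- Codes with generator matrix [ I | M ]

module Systematic (M : Vec (Word n) n) where

  encode decode : Word n → Word n
  encode u = linearCombination u M
  decode v = map (_· v) M

  -- The rows of the transpose of `M`. With them `decode` becomes a linear combination, to which the
  -- same search applies.
  columns : Vec (Word n) n
  columns = map decode (identityMatrix n)

  encode-additive : Additive encode
  encode-additive = linearCombination-additive M

  decode-additive : Additive decode
  decode-additive u v = lemma M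
    where
    lemma : (vs : Vec (Word n) k) → map (_· (u ⊕ v)) vs ≡ map (_· u) vs ⊕ map (_· v) vs
    lemma []       = refl
    lemma (w ∷ vs) = cong₂ _∷_ (·-distribˡ w u v) (lemma vs)

  decode≡linearCombination : ∀ v → linearCombination v columns ≡ decode v
  decode≡linearCombination v = trans
    (sym (additive-linearCombination decode-additive v (identityMatrix n)))
    (cong decode (linearCombination-identityMatrix v))

  generators : Vec (Word (n + n)) n
  generators = zipWith _++_ (identityMatrix n) M

  code : Pred (Word (n + n)) 0ℓ
  code = span generators

  combination≡ : ∀ u → linearCombination u generators ≡ u ++ encode u
  combination≡ u = trans (linearCombination-++ u (identityMatrix n) M)
    (cong (_++ encode u) (linearCombination-identityMatrix u))

  generators-independent : LinearlyIndependent generators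
  generators-independent u eq =
    ++-injectiveˡ u 𝟎 (trans (sym (combination≡ u)) (trans eq (sym (𝟎-++ n))))

  -- The two hypotheses say that the transpose of `M` is its inverse.
  module Orthogonal (decode-encode : ∀ u → decode (encode u) ≡ u) (encode-decode : ∀ v → encode (decode v) ≡ v) where

    -- A map commuting with `encode` commutes with its inverse `decode`; this carries the rotation
    -- symmetry over to right halves.
    columns-commute : {f : Word n → Word n} → (∀ u → encode (f u) ≡ f (encode u)) →
      ∀ v → linearCombination (f v) columns ≡ f (linearCombination v columns)
    columns-commute {f} encode-commute v = begin
      linearCombination (f v) columns   ≡⟨ decode≡linearCombination (f v) ⟩
      decode (f v)                      ≡⟨ cong (decode ∘ f) (encode-decode v) ⟨
      decode (f (encode (decode v)))    ≡⟨ cong decode (encode-commute (decode v)) ⟨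
      decode (encode (f (decode v)))    ≡⟨ decode-encode (f (decode v)) ⟩
      f (decode v)                      ≡⟨ cong f (decode≡linearCombination v) ⟨
      f (linearCombination v columns)   ∎
      where open ≡-Reasoning

    -- `decode` is adjoint to `encode`, so both halves contribute a product with `u`.
    dot-combination : ∀ u (v w : Word n) → (v ++ w) · linearCombination u generators ≡ u · (v ⊕ decode w)
    dot-combination u v w = begin
      (v ++ w) · linearCombination u generators ≡⟨ cong ((v ++ w) ·_) (combination≡ u) ⟩
      (v ++ w) · (u ++ encode u)                ≡⟨ ++-· v u w (encode u) ⟩
      (v · u) xor (w · encode u)                ≡⟨ cong₂ _xor_ (·-comm v u) (trans (·-comm w (encode u)) (linearCombination-· u M w)) ⟩
      (u · v) xor (u · decode w)                ≡⟨ ·-distribˡ u v (decode w) ⟨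
      u · (v ⊕ decode w)                        ∎
      where open ≡-Reasoning

    code-selfDual : SelfDual code
    code-selfDual = (λ v∈ {w} → orthogonal v∈ {w}) , dual⊆code
      where
      orthogonal : code ⊆ dual code
      orthogonal (a , refl) (b , refl) = begin
        linearCombination a generators · linearCombination b generators
          ≡⟨ cong (_· linearCombination b generators) (combination≡ a) ⟩
        (a ++ encode a) · linearCombination b generators ≡⟨ dot-combination b a (encode a) ⟩
        b · (a ⊕ decode (encode a))                      ≡⟨ cong (λ v → b · (a ⊕ v)) (decode-encode a) ⟩
        b · (a ⊕ a)                                      ≡⟨ cong (b ·_) (⊕-self a) ⟩
        b · 𝟎                                            ≡⟨ ·-comm b 𝟎 ⟩
        𝟎 · b                                            ≡⟨ ·-zeroˡ b ⟩
        0₂                                               ∎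
        where open ≡-Reasoning

      dual⊆code : dual code ⊆ code
      dual⊆code {z} z⊥code with splitAt n z
      ... | v , w , refl = v , (begin
        linearCombination v generators  ≡⟨ combination≡ v ⟩
        v ++ encode v                   ≡⟨ cong (λ u → v ++ encode u) v≡decode-w ⟩
        v ++ encode (decode w)          ≡⟨ cong (v ++_) (encode-decode w) ⟩
        v ++ w                          ∎)
        where
        open ≡-Reasoning
        -- Every `u` is orthogonal to `v ⊕ decode w`, and the inner product is nondegenerate.
        v≡decode-w : v ≡ decode w
        v≡decode-w = ⊕≡𝟎⇒≡ (·-nondegenerate (v ⊕ decode w) λ u →
          trans (sym (dot-combination u v w)) (z⊥code (u , refl)))

    code-doublyEven : All (λ v → 4 ∣ weight v) generators → ∀ {c} → c ∈ code → weight c % 4 ≡ 0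
    code-doublyEven 4∣generators (u , refl) = n∣m⇒m%n≡0 _ 4 (4∣weight-linearCombination generators
      (λ a b → proj₁ code-selfDual (a , refl) (b , refl)) 4∣generators u)

    -- A word of weight at most `p + q + 1` has a left half of weight at most `p` or a right half of
    -- weight at most `q`. The matching hypothesis makes that half zero, and each half determines
    -- the word.
    code-bound : ∀ p q →
      (∀ u → weight u ≤ p → weight u + weight (encode u) ≤ suc (p + q) → u ≡ 𝟎) →
      (∀ v → weight v ≤ q → weight v + weight (linearCombination v columns) ≤ suc (p + q) → v ≡ 𝟎) →
      ∀ {c} → c ∈ code → c ≢ 𝟎 → suc (suc (p + q)) ≤ weight c
    code-bound p q left right (u , refl) c≢𝟎 = ≰⇒> λ c-light → c≢𝟎 (begin
      linearCombination u generators  ≡⟨ combination≡ u ⟩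
      u ++ encode u                   ≡⟨ cong (λ u → u ++ encode u) (u≡𝟎 (subst (_≤ suc (p + q)) w≡ c-light)) ⟩
      𝟎 ++ encode 𝟎                   ≡⟨ cong (𝟎 {n} ++_) (additive-𝟎 encode-additive) ⟩
      𝟎 {n} ++ 𝟎                      ≡⟨ 𝟎-++ n ⟩
      𝟎                               ∎)
      where
      open ≡-Reasoning
      w≡ : weight (linearCombination u generators) ≡ weight u + weight (encode u)
      w≡ = trans (cong weight (combination≡ u)) (weight-++ u (encode u))

      decode-encode′ : linearCombination (encode u) columns ≡ u
      decode-encode′ = trans (decode≡linearCombination (encode u)) (decode-encode u)

      u≡𝟎 : weight u + weight (encode u) ≤ suc (p + q) → u ≡ 𝟎
      u≡𝟎 light with ≤-pigeonhole p q light
      ... | inj₁ u≤p = left u u≤p light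
      ... | inj₂ v≤q = trans (sym (decode-encode u)) (trans
        (cong decode (right (encode u) v≤q (subst (_≤ suc (p + q)) (trans (+-comm (weight u) _)
          (cong (λ v → weight (encode u) + weight v) (sym decode-encode′))) light)))
        (additive-𝟎 decode-additive))

    -- The searches run over the halves `l` and `r` of the coset word, since these, and not the
    -- halves of `c`, are the light ones; each is an image of the other shifted by a fixed word.
    coset-bound : ∀ p q (xˡ xʳ : Word n) →
      Exceeds p (suc (p + q)) (encode xˡ ⊕ xʳ) M →
      Exceeds q (suc (p + q)) (linearCombination xʳ columns ⊕ xˡ) columns →
      ∀ {c} → c ∈ code → suc (suc (p + q)) ≤ weight ((xˡ ++ xʳ) ⊕ c)
    coset-bound p q xˡ xʳ left right (u , refl) = subst (suc (p + q) <_) (sym w≡) (≰⇒> heavy)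
      where
      l r : Word n
      l = xˡ ⊕ u
      r = xʳ ⊕ encode u

      w≡ : weight ((xˡ ++ xʳ) ⊕ linearCombination u generators) ≡ weight l + weight r
      w≡ = trans (cong weight (trans (cong ((xˡ ++ xʳ) ⊕_) (combination≡ u))
        (zipWith-++ _xor_ xˡ xʳ u (encode u)))) (weight-++ l r)

      encode-l : encode l ⊕ (encode xˡ ⊕ xʳ) ≡ r
      encode-l = translate-additive encode-additive xˡ u xʳ

      decode-r : linearCombination r columns ⊕ (linearCombination xʳ columns ⊕ xˡ) ≡ l
      decode-r = trans (translate-additive (linearCombination-additive columns) xʳ (encode u) xˡ)
        (cong (xˡ ⊕_) (trans (decode≡linearCombination (encode u)) (decode-encode u)))

      heavy : weight l + weight r ≰ suc (p + q)
      heavy light with ≤-pigeonhole p q light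
      ... | inj₁ l≤p = <⇒≱ (subst (λ v → suc (p + q) < weight l + weight v) encode-l (left l l≤p)) light
      ... | inj₂ r≤q = <⇒≱ (subst (λ v → suc (p + q) < weight r + weight v) decode-r (right r r≤q))
        (subst (_≤ suc (p + q)) (+-comm (weight l) (weight r)) light)

-- With `refl` as second argument, only the Boolean of the decision has to be evaluated, not its
-- proof.
does⇒ : (A? : Dec A) → does A? ≡ true → A
does⇒ (yes a) _ = a

_≟ᵛ_ : (us vs : Vec (Word n) k) → Dec (us ≡ vs)
_≟ᵛ_ = ≡-dec (≡-dec _≟₂_)

∘-additive : {f : Word n → Word k} {g : Word m → Word n} → Additive f → Additive g → Additive (f ∘ g)
∘-additive {f = f} {g} f-additive g-additive u v =
  trans (cong f (g-additive u v)) (f-additive (g u) (g v))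

-- B₈₀,₄ and x₈₀

open Systematic borderedR

-- On unit vectors this says that the rows of `borderedR` are orthonormal over `F₂`, which is
-- checked by evaluation.
decode-encode : ∀ u → decode (encode u) ≡ u
decode-encode = additive-ext {f = decode ∘ encode} {g = id}
  (∘-additive {f = decode} {encode} decode-additive encode-additive) (λ _ _ → refl)
  (does⇒ (map (decode ∘ encode) (identityMatrix 40) ≟ᵛ map id (identityMatrix 40)) refl)

encode-decode : ∀ v → encode (decode v) ≡ v
encode-decode = additive-ext {f = encode ∘ decode} {g = id}
  (∘-additive {f = encode} {decode} encode-additive decode-additive) (λ _ _ → refl)
  (does⇒ (map (encode ∘ decode) (identityMatrix 40) ≟ᵛ map id (identityMatrix 40)) refl)

-- A circulant commutes with cyclic shifts, and the border is constant away from the corner.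
encode-rotate : ∀ u → encode (rotateTail u) ≡ rotateTail (encode u)
encode-rotate = additive-ext {f = encode ∘ rotateTail} {g = rotateTail ∘ encode}
  (∘-additive {f = encode} {rotateTail} encode-additive rotateTail-additive)
  (∘-additive {f = rotateTail} {encode} rotateTail-additive encode-additive)
  (does⇒ (map (encode ∘ rotateTail) (identityMatrix 40) ≟ᵛ map (rotateTail ∘ encode) (identityMatrix 40)) refl)

open Orthogonal decode-encode encode-decode

B-selfDual : SelfDual B₈₀,₄
B-selfDual = code-selfDual

B-doublyEven : ∀ {c} → c ∈ B₈₀,₄ → weight c % 4 ≡ 0
B-doublyEven = code-doublyEven (does⇒ (all? (λ v → 4 ∣? weight v) generators) refl)

xˡ xʳ : Word 40
xˡ = take 40 x₈₀
xʳ = drop 40 x₈₀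

-- The total weight 12 is `suc (6 + 5)`, hence the bounds 6 and 5 for the two halves. The search
-- depths are 5 and 4, as rotation lets one row be fixed.
left-light : ∀ u → weight u ≤ 6 → weight u + weight (encode u) ≤ 12 → u ≡ 𝟎
left-light = searchRotated-sound 5 12 borderedR encode-rotate refl

right-light : ∀ v → weight v ≤ 5 → weight v + weight (linearCombination v columns) ≤ 12 → v ≡ 𝟎
right-light = searchRotated-sound 4 12 columns (columns-commute {f = rotateTail} encode-rotate) refl

-- The total weight 11 is `suc (5 + 5)`. The word `xˡ` is not fixed by `rotateTail`, and the plain
-- search is used on both sides.
left-coset : Exceeds 5 11 (encode xˡ ⊕ xʳ) borderedR
left-coset = search-sound 5 11 (encode xˡ ⊕ xʳ) borderedR refl

right-coset : Exceeds 5 11 (linearCombination xʳ columns ⊕ xˡ) columns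
right-coset = search-sound 5 11 (linearCombination xʳ columns ⊕ xˡ) columns refl

B-bound : ∀ {c} → c ∈ B₈₀,₄ → c ≢ 𝟎 → 13 ≤ weight c
B-bound = code-bound 6 5 left-light right-light

x₈₀+B-bound : ∀ {c} → c ∈ B₈₀,₄ → 12 ≤ weight (x₈₀ ⊕ c)
x₈₀+B-bound {c} c∈B = subst (λ x → 12 ≤ weight (x ⊕ c)) (take++drop≡id 40 x₈₀)
  (coset-bound 5 5 xˡ xʳ left-coset right-coset c∈B)

e₁ : Word 40
e₁ = 0₂ ∷ 1₂ ∷ 𝟎

-- The left half is the unit word at coordinate 2, which is in the support of `x₈₀`, and that
-- support does not meet the right half; hence the product with `x₈₀` is 1.
g : Word 80
g = linearCombination e₁ generatorMatrix

g∈B : g ∈ B₈₀,₄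
g∈B = e₁ , refl

g·x₈₀≡1 : g · x₈₀ ≡ 1₂
g·x₈₀≡1 = refl

open GluedCode B-selfDual x₈₀ {g} g∈B g·x₈₀≡1

-- The first component shows that the second is not vacuous; the second covers every extension,
-- whichever coset is called `C¹`.
proposition7 :
    Extension B₈₀,₄ x₈₀
    × ((E : Extension B₈₀,₄ x₈₀) →
         let C₈₂ = Extension.code E in
           SinglyEvenSelfDual C₈₂
         × Is[ 82 , 41 , 14 ]Code C₈₂
         × HasMinimalShadow C₈₂)
proposition7 = extension (divides 10 refl) B-doublyEven refl , λ E → properties E (code≐glued E)
  where
  properties : (E : Extension B₈₀,₄ x₈₀) → ∃[ b ] Extension.code E ≐ Glued b →
    SinglyEvenSelfDual (Extension.code E) × Is[ 82 , 41 , 14 ]Code (Extension.code E) × HasMinimalShadow (Extension.code E)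
  properties E (b , code≐) =
      D-singlyEven
    , record
      { isSubspace    = D-isSubspace
      ; dimension     = D-hasDimension generatorMatrix generators-independent (id , id)
      ; minimumWeight = D-minimumWeight B-bound x₈₀+B-bound
      }
    , inj₂ (inj₁ (refl , D-shadow B-doublyEven))
    where open Properties code≐ refl
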